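{- Let $N,k$ be positive integers with $N\ge 2k+1$, let $G$ be a connected $r$-regular graph on $m$ vertices, and let $X=C_N^k\square G$. For two distinct vertices $x,y\in V(X)$, we have $$F_X(x\mid y)=\frac{\tau(X)}{Nm(2k+r)}\left\{h_X(x,y)+h_X(y,x)\right\}.$$
   Context: All graphs are finite, simple and undirected; $\mathbb Z_N=\mathbb Z/N\mathbb Z$. $C_N^k$ is the graph with vertex set $\mathbb Z_N$ in which $x,y$ are adjacent iff $x-y\equiv\pm s\pmod N$ for some $1\le s\le k$ (it is $2k$-regular since $N\ge 2k+1$). $X=C_N^k\square G$ is the Cartesian product: vertex set $\mathbb Z_N\times V(G)$, with $(x,a)$ and $(y,b)$ adjacent iff ($a=b$ and $x,y$ are adjacent in $C_N^k$) or ($x=y$ and $a,b$ are adjacent in $G$). $h_X(u,v)$ is the expected value of $T_v=\inf\{t\ge 0: Z_t=v\}$ for the simple random walk $(Z_t)$ on $X$ started at $u$ (each step moves to a uniformly random neighbour). $\tau(X)$ is the number of spanning trees of $X$. For distinct vertices $x,y$, $F_X(x\mid y)$ is the number of spanning forests of $X$ with exactly two connected components in which $x$ and $y$ belong to different components. -}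

module Defs where

open import Data.Bool.Base using (if_then_else_)
open import Data.Fin.Base as Fin using (Fin; toℕ; fromℕ; inject₁)
open import Data.Fin.Properties as Finₚ using (any?; all?; *↔×)
open import Data.Fin.Subset using (Subset; _∈_; inside; outside)
open import Data.Fin.Subset.Properties using (_∈?_)
open import Data.Integer.Base as ℤ using (ℤ; +_)
import Data.Integer.Properties as ℤₚ
import Data.Integer.Divisibility as ℤ
open import Data.List.Base as List
  using (List; []; _∷_; _++_; length; map; filter; concatMap; cartesianProduct; allFin; upTo; foldr)
import Data.List.Membership.Propositional as L
open import Data.List.Membership.Propositional.Properties
  using (∈-filter⁻; ∈-lookup; ∈-map⁺; ∈-allFin)
open import Data.List.Relation.Unary.Any using (here; there)
open import Data.Nat.Base as ℕ using (ℕ; zero; suc; NonZero; _≤_; _<_; _≥_)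
import Data.Nat.Properties as ℕₚ
import Data.Nat.Divisibility as ℕ
open import Data.Product using (∃; _×_; _,_; proj₁; proj₂)
open import Data.Product.Function.NonDependent.Propositional using (_×-↔_)
open import Data.Product.Properties using (≡-dec)
open import Data.Rational.Base as ℚ using (ℚ; 0ℚ; 1ℚ; _/_)
open import Data.Sum.Base as Sum using (_⊎_; inj₁; inj₂)
open import Data.Vec.Base as Vec using (Vec; []; _∷_)
open import Function.Base using (_∘_)
open import Function.Bundles using (_↔_; Inverse)
open import Function.Construct.Composition using (_↔-∘_)
open import Function.Construct.Identity using (↔-id)
open import Function.Construct.Symmetry using (↔-sym)
open import Level using (0ℓ)
open import Relation.Binary.Core using (Rel)
open import Relation.Binary.Definitions as B using ()
open import Relation.Binary.Construct.Closure.ReflexiveTransitive using (Star; ε; _◅_; _◅◅_)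
open import Relation.Binary.PropositionalEquality
open import Relation.Nullary using (Dec; does; ¬_)
open import Relation.Nullary.Decidable using (map′; _×-dec_; _⊎-dec_; _→-dec_; ¬?)
open import Relation.Unary using (Pred; Decidable)

record Graph : Set₁ where
  field
    V         : Set
    order     : ℕ
    indexing  : V ↔ Fin order
    Adj       : Rel V 0ℓ
    adj?      : B.Decidable Adj
    adj-sym   : B.Symmetric Adj
    adj-irr   : ∀ {x} → ¬ Adj x x

  index : V → Fin order
  index = Inverse.to indexing

  vertex : Fin order → V
  vertex = Inverse.from indexing

  vertex-index : ∀ v → vertex (index v) ≡ v
  vertex-index = Inverse.strictlyInverseʳ indexing

  index-injective : ∀ {u v} → index u ≡ index v → u ≡ v
  index-injective {u} {v} eq =
    trans (sym (vertex-index u)) (trans (cong vertex eq) (vertex-index v))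

  vertices : List V
  vertices = map vertex (allFin order)

  ∈-vertices : ∀ v → v L.∈ vertices
  ∈-vertices v = subst (L._∈ vertices) (vertex-index v) (∈-map⁺ vertex (∈-allFin (index v)))

  infix 4 _≟_
  _≟_ : B.DecidableEquality V
  u ≟ v = map′ index-injective (cong index) (index u Finₚ.≟ index v)

  anyV? : ∀ {P : Pred V 0ℓ} → Decidable P → Dec (∃ P)
  anyV? {P} P? = map′ (λ (i , p) → vertex i , p)
                      (λ (v , p) → index v , subst P (sym (vertex-index v)) p)
                      (any? (P? ∘ vertex))

  allV? : ∀ {P : Pred V 0ℓ} → Decidable P → Dec (∀ v → P v)
  allV? {P} P? = map′ (λ p v → subst P (vertex-index v) (p (index v)))
                      (λ p i → p (vertex i))
                      (all? (P? ∘ vertex))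

  anyVec? : ∀ n {P : Pred (Vec V n) 0ℓ} → Decidable P → Dec (∃ P)
  anyVec? zero    P? = map′ ([] ,_) (λ { ([] , p) → p }) (P? [])
  anyVec? (suc n) P? = map′ (λ (v , vs , p) → (v ∷ vs) , p)
                            (λ { (v ∷ vs , p) → v , vs , p })
                            (anyV? (λ v → anyVec? n (λ vs → P? (v ∷ vs))))

  degree : V → ℕ
  degree v = length (filter (adj? v) vertices)

  -- Each edge is listed exactly once, as the pair whose first endpoint has the smaller index.
  edge? : Decidable (λ (e : V × V) → (index (proj₁ e) Fin.< index (proj₂ e)) × Adj (proj₁ e) (proj₂ e))
  edge? (u , v) = (index u Finₚ.<? index v) ×-dec adj? u v

  edges : List (V × V)
  edges = filter edge? (cartesianProduct vertices vertices)

  Reachable : Rel V 0ℓ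
  Reachable = Star Adj

open Graph public using (V; order; degree; Reachable)

module _ (G : Graph) where
  open Graph G hiding (V; order; degree; Reachable)

  Connected : Set
  Connected = ∀ u v → Reachable G u v

  Regular : ℕ → Set
  Regular r = ∀ v → degree G v ≡ r

  -- A cycle visits l + 3 distinct vertices, so closed walks of length 2 do not count.
  IsCycle : ∀ l → Pred (Vec (V G) (3 ℕ.+ l)) 0ℓ
  IsCycle l c =
      (∀ i j → Vec.lookup c i ≡ Vec.lookup c j → i ≡ j)
    × (∀ (i : Fin (2 ℕ.+ l)) → Adj (Vec.lookup c (inject₁ i)) (Vec.lookup c (Fin.suc i)))
    × Adj (Vec.last c) (Vec.head c)

  Acyclic : Set
  Acyclic = ¬ (∃ λ l → ∃ (IsCycle l))

  IsTree : Set
  IsTree = Connected × Acyclic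

  -- A vector containing exactly one vertex from each connected component.
  IsTransversal : ∀ {c} → Pred (Vec (V G) c) 0ℓ
  IsTransversal t =
      (∀ i j → Reachable G (Vec.lookup t i) (Vec.lookup t j) → i ≡ j)
    × (∀ v → ∃ λ i → Reachable G v (Vec.lookup t i))

  HasComponents : ℕ → Set
  HasComponents c = ∃ (IsTransversal {c})

  -- Via zs x y: there is a walk from x to y all of whose interior vertices lie in zs.
  private
    Via : List (V G) → Rel (V G) 0ℓ
    Via []       x y = x ≡ y ⊎ Adj x y
    Via (z ∷ zs) x y = Via zs x y ⊎ (Via zs x z × Via zs z y)

    via? : ∀ zs → B.Decidable (Via zs)
    via? []       x y = (x ≟ y) ⊎-dec adj? x y
    via? (z ∷ zs) x y = via? zs x y ⊎-dec (via? zs x z ×-dec via? zs z y)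

    via-base : ∀ zs {x y} → x ≡ y ⊎ Adj x y → Via zs x y
    via-base []       p = p
    via-base (z ∷ zs) p = inj₁ (via-base zs p)

    via-sound : ∀ zs {x y} → Via zs x y → Reachable G x y
    via-sound []       (inj₁ refl)    = ε
    via-sound []       (inj₂ a)       = a ◅ ε
    via-sound (z ∷ zs) (inj₁ p)       = via-sound zs p
    via-sound (z ∷ zs) (inj₂ (p , q)) = via-sound zs p ◅◅ via-sound zs q

    via-trans : ∀ {zs x z y} → z L.∈ zs → Via zs x z → Via zs z y → Via zs x y
    via-trans (here refl) p q = inj₂ (toHead p , fromHead q)
      where
      toHead : ∀ {zs x w} → Via (w ∷ zs) x w → Via zs x w
      toHead (inj₁ p)       = p
      toHead (inj₂ (p , _)) = p
      fromHead : ∀ {zs w y} → Via (w ∷ zs) w y → Via zs w y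
      fromHead (inj₁ q)       = q
      fromHead (inj₂ (_ , q)) = q
    via-trans (there i) (inj₁ p)        (inj₁ q)        = inj₁ (via-trans i p q)
    via-trans (there i) (inj₁ p)        (inj₂ (q , q′)) = inj₂ (via-trans i p q , q′)
    via-trans (there i) (inj₂ (p , p′)) (inj₁ q)        = inj₂ (p , via-trans i p′ q)
    via-trans (there i) (inj₂ (p , p′)) (inj₂ (q , q′)) = inj₂ (p , q′)

    via-complete : ∀ {x y} → Reachable G x y → Via vertices x y
    via-complete ε       = via-base vertices (inj₁ refl)
    via-complete (a ◅ w) =
      via-trans (∈-vertices _) (via-base vertices (inj₂ a)) (via-complete w)

  reachable? : B.Decidable (Reachable G)
  reachable? x y = map′ (via-sound vertices) via-complete (via? vertices x y)

  connected? : Dec Connected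
  connected? = allV? λ u → allV? λ v → reachable? u v

  isCycle? : ∀ l → Decidable (IsCycle l)
  isCycle? l c =
          all? (λ i → all? λ j → (Vec.lookup c i ≟ Vec.lookup c j) →-dec (i Finₚ.≟ j))
    ×-dec all? (λ i → adj? (Vec.lookup c (inject₁ i)) (Vec.lookup c (Fin.suc i)))
    ×-dec adj? (Vec.last c) (Vec.head c)

  cycle-bound : ∀ l → ∃ (IsCycle l) → l < order G
  cycle-bound l (c , inj , _) =
    ℕₚ.≤-trans (ℕₚ.m≤n+m (suc l) 2)
      (Finₚ.injective⇒≤ {f = index ∘ Vec.lookup c} (λ eq → inj _ _ (index-injective eq)))

  acyclic? : Dec Acyclic
  acyclic? = ¬? (map′ (λ (l , _ , c) → l , c) (λ (l , c) → l , cycle-bound l c , c)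
                      (ℕₚ.anyUpTo? (λ l → anyVec? (3 ℕ.+ l) (isCycle? l)) (order G)))

  isTree? : Dec IsTree
  isTree? = connected? ×-dec acyclic?

  hasComponents? : ∀ c → Dec (HasComponents c)
  hasComponents? c = anyVec? c λ t →
          all? (λ i → all? λ j → reachable? (Vec.lookup t i) (Vec.lookup t j) →-dec (i Finₚ.≟ j))
    ×-dec allV? (λ v → any? λ i → reachable? v (Vec.lookup t i))

  private
    edge-irr : ∀ {x} i → List.lookup edges i ≢ (x , x)
    edge-irr i eq with ∈-filter⁻ edge? {xs = cartesianProduct vertices vertices} (∈-lookup {xs = edges} i)
    ... | _ , lt , _ rewrite eq = Finₚ.<-irrefl refl lt

  -- The spanning subgraph whose edge set is S.
  spanning : Subset (length edges) → Graph
  spanning S = record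
    { V        = V G
    ; order    = order G
    ; indexing = indexing
    ; Adj      = λ x y → ∃ λ i → i ∈ S × (List.lookup edges i ≡ (x , y) ⊎ List.lookup edges i ≡ (y , x))
    ; adj?     = λ x y → any? λ i → (i ∈? S) ×-dec
                   (≡-dec _≟_ _≟_ (List.lookup edges i) (x , y) ⊎-dec
                    ≡-dec _≟_ _≟_ (List.lookup edges i) (y , x))
    ; adj-sym  = λ (i , i∈S , e) → i , i∈S , Sum.swap e
    ; adj-irr  = λ (i , _ , e) → Sum.[ edge-irr i , edge-irr i ] e
    }

subsets : ∀ n → List (Subset n)
subsets zero    = [] ∷ []
subsets (suc n) = map (outside ∷_) (subsets n) ++ map (inside ∷_) (subsets n)

τ : Graph → ℕ
τ G = length (filter (λ S → isTree? (spanning G S)) (subsets (length (Graph.edges G))))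

module _ (G : Graph) (x y : V G) where

  -- Reachability is taken in the forest, not in G.
  Separating : Subset (length (Graph.edges G)) → Set
  Separating S = Acyclic H × HasComponents H 2 × ¬ Reachable H x y
    where H = spanning G S

  separating? : Decidable Separating
  separating? S = acyclic? H ×-dec hasComponents? H 2 ×-dec ¬? (reachable? H x y)
    where H = spanning G S

  -- F G x y is F_G(x ∣ y).
  F : ℕ
  F = length (filter separating? (subsets (length (Graph.edges G))))

sumℚ : List ℚ → ℚ
sumℚ = foldr ℚ._+_ 0ℚ

ConvergesTo : (ℕ → ℚ) → ℚ → Set
ConvergesTo s l = ∀ ε → 0ℚ ℚ.< ε → ∃ λ M → ∀ n → M ≤ n → ℚ.∣ s n ℚ.- l ∣ ℚ.< ε

_sumsTo_ : (ℕ → ℚ) → ℚ → Set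
a sumsTo l = ConvergesTo (λ n → sumℚ (map a (upTo n))) l

module RandomWalk (G : Graph) where
  open Graph G hiding (V; order; degree; Reachable)

  -- The value at 0 is never used: a vertex with a neighbour has positive degree.
  reciprocal : ℕ → ℚ
  reciprocal zero    = 0ℚ
  reciprocal (suc d) = + 1 / suc d

  step : V G → V G → ℚ
  step u w = if does (adj? u w) then reciprocal (degree G u) else 0ℚ

  trajectories : ∀ t → List (Vec (V G) t)
  trajectories zero    = [] ∷ []
  trajectories (suc t) = concatMap (λ w → map (w ∷_) (trajectories t)) vertices

  -- The probability that (Z₁, …, Z_t) = ws given Z₀ = u.
  probability : ∀ {t} → V G → Vec (V G) t → ℚ
  probability u []       = 1ℚ
  probability u (w ∷ ws) = step u w ℚ.* probability w ws

  -- The event T_v = t for (Z₀, …, Z_t) = zs.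
  FirstHit : ∀ {t} → V G → Vec (V G) (suc t) → Set
  FirstHit {t} v zs =
    Vec.lookup zs (fromℕ t) ≡ v × (∀ (s : Fin t) → Vec.lookup zs (inject₁ s) ≢ v)

  firstHit? : ∀ {t} v → Decidable (FirstHit {t} v)
  firstHit? {t} v zs =
    (Vec.lookup zs (fromℕ t) ≟ v) ×-dec all? (λ s → ¬? (Vec.lookup zs (inject₁ s) ≟ v))

  -- P_u(T_v = t).
  hitProbability : V G → V G → ℕ → ℚ
  hitProbability u v t =
    sumℚ (map (probability u) (filter (λ ws → firstHit? v (u ∷ ws)) (trajectories t)))

  -- E_u[T_v] = h. The first condition says that T_v < ∞ almost surely, without which
  -- the expectation would be infinite.
  IsHittingTime : V G → V G → ℚ → Set
  IsHittingTime u v h =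
      hitProbability u v sumsTo 1ℚ
    × (λ t → (+ t / 1) ℚ.* hitProbability u v t) sumsTo h

open RandomWalk public using (IsHittingTime)

_≡_[mod_] : ℤ → ℤ → ℕ → Set
i ≡ j [mod N ] = (+ N) ℤ.∣ (i ℤ.- j)

-- ℤ/Nℤ is represented by the residues Fin N.
module _ (N k : ℕ) where

  difference : Fin N → Fin N → ℤ
  difference x y = + toℕ x ℤ.- + toℕ y

  CycleAdj : Rel (Fin N) 0ℓ
  CycleAdj x y = ∃ λ s → 1 ≤ s × s ≤ k ×
    (difference x y ≡ + s [mod N ] ⊎ difference x y ≡ ℤ.- (+ s) [mod N ])

  private
    cycleAdj? : B.Decidable CycleAdj
    cycleAdj? x y =
      map′ (λ (s , s<1+k , 1≤s , p) → s , 1≤s , ℕ.s≤s⁻¹ s<1+k , p)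
           (λ (s , 1≤s , s≤k , p) → s , ℕ.s≤s s≤k , 1≤s , p)
           (ℕₚ.anyUpTo? (λ s → (1 ℕₚ.≤? s) ×-dec ((N ℕ.∣? _) ⊎-dec (N ℕ.∣? _))) (suc k))

    negate : ∀ a b s → ℤ.∣ (a ℤ.- b) ℤ.- s ∣ ≡ ℤ.∣ (b ℤ.- a) ℤ.- ℤ.- s ∣
    negate a b s = begin
      ℤ.∣ (a ℤ.- b) ℤ.- s ∣             ≡⟨ ℤₚ.∣-i∣≡∣i∣ ((a ℤ.- b) ℤ.- s) ⟨
      ℤ.∣ ℤ.- ((a ℤ.- b) ℤ.- s) ∣       ≡⟨ cong ℤ.∣_∣ (ℤₚ.neg-distrib-+ (a ℤ.- b) (ℤ.- s)) ⟩
      ℤ.∣ ℤ.- (a ℤ.- b) ℤ.- ℤ.- s ∣     ≡⟨ cong (λ i → ℤ.∣ i ℤ.- ℤ.- s ∣) (swap a b) ⟩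
      ℤ.∣ (b ℤ.- a) ℤ.- ℤ.- s ∣         ∎
      where
      open ≡-Reasoning
      swap : ∀ a b → ℤ.- (a ℤ.- b) ≡ b ℤ.- a
      swap a b = trans (ℤₚ.neg-distrib-+ a (ℤ.- b))
                (trans (cong (λ c → ℤ.- a ℤ.+ c) (ℤₚ.neg-involutive b)) (ℤₚ.+-comm (ℤ.- a) b))

    cycleAdj-sym : B.Symmetric CycleAdj
    cycleAdj-sym {x} {y} (s , 1≤s , s≤k , inj₁ p) =
      s , 1≤s , s≤k , inj₂ (subst (N ℕ.∣_) (negate (+ toℕ x) (+ toℕ y) (+ s)) p)
    cycleAdj-sym {x} {y} (s , 1≤s , s≤k , inj₂ p) =
      s , 1≤s , s≤k , inj₁ (subst (N ℕ.∣_) (trans (negate (+ toℕ x) (+ toℕ y) (ℤ.- (+ s)))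
        (cong (λ i → ℤ.∣ (+ toℕ y ℤ.- + toℕ x) ℤ.- i ∣) (ℤₚ.neg-involutive (+ s)))) p)

    cycleAdj-irr : N ≥ 2 ℕ.* k ℕ.+ 1 → ∀ {x} → ¬ CycleAdj x x
    cycleAdj-irr N≥2k+1 {x} (s , 1≤s , s≤k , p) =
      ℕ.>⇒∤ {{ℕ.>-nonZero 1≤s}} s<N (Sum.[ subst (N ℕ.∣_) minus , subst (N ℕ.∣_) plus ] p)
      where
      s<N : s < N
      s<N = ℕₚ.≤-trans (ℕ.s≤s (ℕₚ.≤-trans s≤k (ℕₚ.m≤n*m k 2)))
                       (subst (_≤ N) (ℕₚ.+-comm (2 ℕ.* k) 1) N≥2k+1)
      minus : ℤ.∣ difference x x ℤ.- + s ∣ ≡ s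
      minus = trans (cong (λ i → ℤ.∣ i ℤ.- + s ∣) (ℤₚ.+-inverseʳ (+ toℕ x)))
             (trans (cong ℤ.∣_∣ (ℤₚ.+-identityˡ (ℤ.- + s))) (ℤₚ.∣-i∣≡∣i∣ (+ s)))
      plus : ℤ.∣ difference x x ℤ.- ℤ.- + s ∣ ≡ s
      plus = trans (cong (λ i → ℤ.∣ i ℤ.- ℤ.- + s ∣) (ℤₚ.+-inverseʳ (+ toℕ x)))
            (trans (cong ℤ.∣_∣ (ℤₚ.+-identityˡ (ℤ.- ℤ.- + s)))
                   (cong ℤ.∣_∣ (ℤₚ.neg-involutive (+ s))))

  -- C_N^k; the bound on N is what excludes loops.
  cyclePower : N ≥ 2 ℕ.* k ℕ.+ 1 → Graph
  cyclePower N≥2k+1 = record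
    { V        = Fin N
    ; order    = N
    ; indexing = ↔-id _
    ; Adj      = CycleAdj
    ; adj?     = cycleAdj?
    ; adj-sym  = λ {x} {y} → cycleAdj-sym {x} {y}
    ; adj-irr  = λ {x} → cycleAdj-irr N≥2k+1 {x}
    }

infixr 6 _□_

_□_ : Graph → Graph → Graph
G □ H = record
  { V        = V G × V H
  ; order    = order G ℕ.* order H
  ; indexing = ↔-sym *↔× ↔-∘ (G.indexing ×-↔ H.indexing)
  ; Adj      = λ (x , a) (y , b) → (a ≡ b × G.Adj x y) ⊎ (x ≡ y × H.Adj a b)
  ; adj?     = λ (x , a) (y , b) → ((a H.≟ b) ×-dec G.adj? x y) ⊎-dec ((x G.≟ y) ×-dec H.adj? a b)
  ; adj-sym  = Sum.map (λ (eq , e) → sym eq , G.adj-sym e) (λ (eq , e) → sym eq , H.adj-sym e)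
  ; adj-irr  = Sum.[ G.adj-irr ∘ proj₂ , H.adj-irr ∘ proj₂ ]
  }
  where
  module G = Graph G
  module H = Graph H

order≢0 : (G : Graph) → V G → NonZero (order G)
order≢0 G v = Finₚ.nonZeroIndex (Graph.index G v)

denominator≢0 : ∀ N m k r .{{_ : NonZero N}} .{{_ : NonZero m}} .{{_ : NonZero k}} →
  NonZero (N ℕ.* m ℕ.* (2 ℕ.* k ℕ.+ r))
denominator≢0 N m k@(suc _) r = ℕₚ.m*n≢0 (N ℕ.* m) (2 ℕ.* k ℕ.+ r) {{ℕₚ.m*n≢0 N m}}

{-# OPTIONS --safe #-}

-- Let F(xw∣y) count the spanning forests with two components, one containing x and w and the other
-- containing y.  The function h(x) = τ⁻¹ Σ_w deg(w) F(xw∣y) vanishes at y, and for x ≠ y it exceeds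
-- the average of h over the neighbours of x by exactly 1.  To see this, cancel the forests with x and z
-- in the same component: F(xw∣y) − F(zw∣y) = F(xw∣zy) − F(zw∣xy).  Adding the edge xz turns the forests
-- counted by F(xw∣zy) into the trees in which xz is the first edge on the way from x to y but not on the
-- way from x to w.  A tree has exactly one first edge from x towards each other vertex, so the sum of
-- F(xw∣zy) − F(zw∣xy) over the neighbours z of x is τ if w = x, and 0 otherwise.
--
-- Let Q be the transition operator of the walk killed at y.  Then h = 1 + Qh off y and h ≤ C, so Qᵗh
-- shrinks by a fixed factor at each step.  The defects of the partial sums of Σ P(T = t) and Σ t P(T = t)
-- are Qᵗ1 ≤ Qᵗh and Qᵗh + t Qᵗ1, which tend to 0, and h(x) is the expected hitting time of y.
--
-- In a forest separating x from y, each w lies with exactly one of x and y.  Summing over w therefore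
-- gives h(x,y) + h(y,x) = τ⁻¹ F(x∣y) Σ_w deg(w), and X is connected and (2k+r)-regular.

module Submission where

open import Defs
open import Algebra.Bundles using (CommutativeRing; CommutativeSemiring)
open import Data.Bool.Base using (true; false; if_then_else_)
open import Data.Fin.Base as Fin using (Fin; toℕ; fromℕ; inject₁)
import Data.Fin.Properties as Finₚ
open import Data.Fin.Subset using (Subset; _∈_; _∉_; _⊆_; _-_; ⊤; ∣_∣; inside; outside)
open import Data.Fin.Subset.Properties as Subsetₚ
  using (_∈?_; p─⊥≡p; p─q⊆p; x∈p∧x≢y⇒x∈p-y; p─x─y≡p─y─x)
open import Data.Integer.Base as ℤ using (+_; -[1+_])
import Data.Integer.Divisibility as ℤ
import Data.Integer.Divisibility.Signed as Signed
import Data.Integer.DivMod as ℤ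
import Data.Integer.Properties as ℤₚ
open import Data.Integer.Solver using () renaming (module +-*-Solver to ℤ-Solver)
open import Data.List.Base as List
  using (List; []; _∷_; _++_; length; map; filter; foldr; concatMap; cartesianProduct; lookup; allFin; upTo)
import Data.List.Membership.Propositional as L
open import Data.List.Membership.Propositional.Properties
  using (∈-++⁺ˡ; ∈-++⁺ʳ; ∈-map⁺; ∈-lookup; ∈-filter⁺; ∈-filter⁻; ∈-cartesianProduct⁺; ∈-allFin; ∈-upTo⁺; ∈-upTo⁻)
open import Data.List.Properties using (map-∘; length-map; length-tabulate; length-upTo; upTo-∷ʳ)
open import Data.List.Relation.Unary.All as All using ([]; _∷_)
open import Data.List.Relation.Unary.AllPairs using ([]; _∷_)
open import Data.List.Relation.Unary.Any using (here; there)
import Data.List.Relation.Unary.Any.Properties as Anyₚ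
open import Data.List.Relation.Unary.Unique.Propositional using (Unique)
import Data.List.Relation.Unary.Unique.Propositional.Properties as Unique
open import Data.Nat.Base as ℕ using (ℕ; zero; suc; NonZero; _≥_)
import Data.Nat.Divisibility as ℕ
open import Data.Nat.Induction using (<-wellFounded)
import Data.Nat.Properties as ℕₚ
open import Data.Nat.Solver using (module +-*-Solver)
open import Data.Product using (∃; ∃₂; _×_; _,_; proj₁; proj₂)
open import Data.Product.Properties using (≡-dec; ,-injectiveˡ; ,-injectiveʳ)
open import Data.Rational.Base as ℚ using (ℚ; mkℚ; 0ℚ; 1ℚ; _/_)
import Data.Rational.Properties as ℚₚ
open import Data.Rational.Solver using () renaming (module +-*-Solver to ℚ-Solver)
open import Data.Rational.Unnormalised.Base as ℚᵘ using (mkℚᵘ)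
import Data.Rational.Unnormalised.Properties as ℚᵘₚ
open import Data.Sum.Base as Sum using (_⊎_; inj₁; inj₂)
open import Data.Vec.Base as Vec using (Vec; []; _∷_)
import Data.Vec.Membership.DecPropositional as DecV
import Data.Vec.Membership.Propositional as V
import Data.Vec.Membership.Propositional.Properties as V
open import Data.Vec.Relation.Unary.Any using (here; there)
open import Function.Base using (_∘_; id; it)
open import Function.Bundles using (Inverse)
open import Induction.WellFounded using (Acc; acc)
open import Level using (Level; 0ℓ)
open import Relation.Binary.Construct.Closure.ReflexiveTransitive as Star using (Star; ε; _◅_; _◅◅_)
open import Relation.Binary.Core using (Rel)
open import Relation.Binary.Definitions using (DecidableEquality; tri<; tri≈; tri>)
open import Relation.Binary.PropositionalEquality as ≡ using (_≡_; _≢_)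
open import Relation.Nullary using (Dec; yes; no; does; ¬_; contradiction)
open import Relation.Nullary.Decidable using (_×-dec_; _⊎-dec_; ¬?)
open import Relation.Unary using (Pred; Decidable)

-- The candidate h comes from the Green function: for the walk from x, the expected number of visits
-- to w before y is τ⁻¹ deg(w) F(xw∣y), the inverse of the reduced Laplacian written with forests.
-- Summing over w gives the hitting time. It is enough to check that h solves the right equation, so
-- no determinant or inverse matrix appears.
--
-- The forest identities contain differences of counts that are natural numbers, so each is stated
-- with its negative terms moved across, and a common term is cancelled at the end. Acyclicity,
-- defined through cycles, is awkward to follow while one edge is deleted or restored; it is traded
-- for the condition that every edge is a bridge.
--
-- On the analytic side no uniqueness of solutions is invoked: the partial sums and their defects
-- add up exactly to 1 and to h(x). Since the defect of the mean carries a factor t, Qᵗh has to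
-- decay faster than 1/t, and a rate of order 1/t² is all that is extracted from the contraction.

private variable
  a b p q : Level
  A : Set a
  B : Set b
  P : Set p
  Q : Set q

-- Finite sums and indicators in a commutative semiring

module Summation {c ℓ} (R : CommutativeSemiring c ℓ) where
  open CommutativeSemiring R
  open import Relation.Binary.Reasoning.Setoid setoid
  open import Algebra.Properties.CommutativeSemigroup +-commutativeSemigroup using (interchange)

  ∑ : List A → (A → Carrier) → Carrier
  ∑ xs f = foldr _+_ 0# (map f xs)

  infixr 7.5 ∑
  syntax ∑ xs (λ x → e) = ∑[ x ← xs ] e

  ⟦_⟧ : Dec P → Carrier
  ⟦ P? ⟧ = if does P? then 1# else 0#

  ⟦⟧-yes : (P? : Dec P) → P → ⟦ P? ⟧ ≈ 1#
  ⟦⟧-yes (yes _) _ = refl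
  ⟦⟧-yes (no ¬p) p = contradiction p ¬p

  ⟦⟧-no : (P? : Dec P) → ¬ P → ⟦ P? ⟧ ≈ 0#
  ⟦⟧-no (yes p) ¬p = contradiction p ¬p
  ⟦⟧-no (no _)  _  = refl

  ⟦⟧-cong : (P? : Dec P) (Q? : Dec Q) → (P → Q) → (Q → P) → ⟦ P? ⟧ ≈ ⟦ Q? ⟧
  ⟦⟧-cong (yes p) Q? to from = sym (⟦⟧-yes Q? (to p))
  ⟦⟧-cong (no ¬p) Q? to from = sym (⟦⟧-no Q? (¬p ∘ from))

  ⟦⟧-× : (P? : Dec P) (Q? : Dec Q) (R? : Dec (P × Q)) → ⟦ R? ⟧ ≈ ⟦ P? ⟧ * ⟦ Q? ⟧
  ⟦⟧-× (no ¬p) Q?      R? = trans (⟦⟧-no R? (¬p ∘ proj₁)) (sym (zeroˡ ⟦ Q? ⟧))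
  ⟦⟧-× (yes _) (no ¬q) R? = trans (⟦⟧-no R? (¬q ∘ proj₂)) (sym (zeroʳ 1#))
  ⟦⟧-× (yes p) (yes q) R? = trans (⟦⟧-yes R? (p , q)) (sym (*-identityˡ 1#))

  ∑-cong-∈ : ∀ (xs : List A) {f g} → (∀ {x} → x L.∈ xs → f x ≈ g x) → ∑ xs f ≈ ∑ xs g
  ∑-cong-∈ []       f≈g = refl
  ∑-cong-∈ (x ∷ xs) f≈g = +-cong (f≈g (here ≡.refl)) (∑-cong-∈ xs (f≈g ∘ there))

  ∑-cong : ∀ (xs : List A) {f g} → (∀ x → f x ≈ g x) → ∑ xs f ≈ ∑ xs g
  ∑-cong xs f≈g = ∑-cong-∈ xs λ {x} _ → f≈g x

  ∑-zero-∈ : ∀ (xs : List A) {f} → (∀ {x} → x L.∈ xs → f x ≈ 0#) → ∑ xs f ≈ 0#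
  ∑-zero-∈ []       f≈0 = refl
  ∑-zero-∈ (x ∷ xs) f≈0 =
    trans (+-cong (f≈0 (here ≡.refl)) (∑-zero-∈ xs (f≈0 ∘ there))) (+-identityˡ 0#)

  ∑-zero : ∀ (xs : List A) {f} → (∀ x → f x ≈ 0#) → ∑ xs f ≈ 0#
  ∑-zero xs f≈0 = ∑-zero-∈ xs λ {x} _ → f≈0 x

  ∑-distrib-+ : ∀ (xs : List A) f g → ∑[ x ← xs ] (f x + g x) ≈ ∑ xs f + ∑ xs g
  ∑-distrib-+ []       f g = sym (+-identityˡ 0#)
  ∑-distrib-+ (x ∷ xs) f g = trans (+-congˡ (∑-distrib-+ xs f g)) (interchange _ _ _ _)

  *-distribˡ-∑ : ∀ (xs : List A) c f → c * ∑ xs f ≈ ∑[ x ← xs ] (c * f x)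
  *-distribˡ-∑ []       c f = zeroʳ c
  *-distribˡ-∑ (x ∷ xs) c f = trans (distribˡ c _ _) (+-congˡ (*-distribˡ-∑ xs c f))

  *-distribʳ-∑ : ∀ (xs : List A) c f → ∑ xs f * c ≈ ∑[ x ← xs ] (f x * c)
  *-distribʳ-∑ xs c f =
    trans (*-comm _ c) (trans (*-distribˡ-∑ xs c f) (∑-cong xs (λ x → *-comm c (f x))))

  ∑-comm : ∀ (xs : List A) (ys : List B) (f : A → B → Carrier) →
           ∑[ x ← xs ] ∑[ y ← ys ] f x y ≈ ∑[ y ← ys ] ∑[ x ← xs ] f x y
  ∑-comm []       ys f = sym (∑-zero ys (λ _ → refl))
  ∑-comm (x ∷ xs) ys f = trans (+-congˡ (∑-comm xs ys f)) (sym (∑-distrib-+ ys _ _))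

  ∑-++ : ∀ (xs ys : List A) f → ∑ (xs ++ ys) f ≈ ∑ xs f + ∑ ys f
  ∑-++ []       ys f = sym (+-identityˡ _)
  ∑-++ (x ∷ xs) ys f = trans (+-congˡ (∑-++ xs ys f)) (sym (+-assoc _ _ _))

  ∑-map : ∀ (g : A → B) xs f → ∑ (map g xs) f ≈ ∑ xs (f ∘ g)
  ∑-map g xs f = reflexive (≡.cong (foldr _+_ 0#) (≡.sym (map-∘ xs)))

  ∑-concatMap : ∀ (g : A → List B) xs f → ∑ (concatMap g xs) f ≈ ∑[ x ← xs ] ∑ (g x) f
  ∑-concatMap g []       f = refl
  ∑-concatMap g (x ∷ xs) f = trans (∑-++ (g x) (concatMap g xs) f) (+-congˡ (∑-concatMap g xs f))

  ∑-cartesianProduct : ∀ (xs : List A) (ys : List B) f →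
                       ∑ (cartesianProduct xs ys) f ≈ ∑[ x ← xs ] ∑[ y ← ys ] f (x , y)
  ∑-cartesianProduct []       ys f = refl
  ∑-cartesianProduct (x ∷ xs) ys f =
    trans (∑-++ (map (x ,_) ys) _ f)
          (+-cong (∑-map (x ,_) ys f) (∑-cartesianProduct xs ys f))

  ∑-filter : ∀ {P : Pred A p} (P? : Decidable P) xs f →
             ∑ (filter P? xs) f ≈ ∑[ x ← xs ] (⟦ P? x ⟧ * f x)
  ∑-filter P? []       f = refl
  ∑-filter P? (x ∷ xs) f with does (P? x)
  ... | true  = +-cong (sym (*-identityˡ (f x))) (∑-filter P? xs f)
  ... | false = trans (∑-filter P? xs f) (sym (trans (+-congʳ (zeroˡ (f x))) (+-identityˡ _)))

  ∑-single : ∀ {xs : List A} {x f} → Unique xs → x L.∈ xs →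
             (∀ {y} → y L.∈ xs → y ≢ x → f y ≈ 0#) → ∑ xs f ≈ f x
  ∑-single (x∉xs ∷ _) (here ≡.refl) f≈0 =
    trans (+-congˡ (∑-zero-∈ _ λ y∈xs → f≈0 (there y∈xs) (All.lookup x∉xs y∈xs ∘ ≡.sym)))
          (+-identityʳ _)
  ∑-single (y∉xs ∷ u) (there x∈xs) f≈0 =
    trans (+-cong (f≈0 (here ≡.refl) (All.lookup y∉xs x∈xs)) (∑-single u x∈xs (f≈0 ∘ there)))
          (+-identityˡ _)

  -- Turns unique existence into an equation between numbers: at most one summand is 1, and `Q`
  -- decides whether there is one. It counts the edge joining two vertices, the first edge of a tree
  -- path, and the offset between two residues.
  ∑-unique : ∀ {xs : List A} {P : Pred A p} (P? : Decidable P) → Unique xs →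
             (∀ {x y} → x L.∈ xs → y L.∈ xs → P x → P y → x ≡ y) →
             (Q? : Dec Q) → (Q → ∃ λ x → x L.∈ xs × P x) → (∀ {x} → x L.∈ xs → P x → Q) →
             ∑[ x ← xs ] ⟦ P? x ⟧ ≈ ⟦ Q? ⟧
  ∑-unique P? u prop (yes q) to from with x , x∈xs , px ← to q =
    trans (∑-single u x∈xs (λ {y} y∈xs y≢x → ⟦⟧-no (P? y) (λ py → y≢x (prop y∈xs x∈xs py px))))
          (⟦⟧-yes (P? x) px)
  ∑-unique {xs = xs} P? u prop (no ¬q) to from =
    ∑-zero-∈ xs λ {x} x∈xs → ⟦⟧-no (P? x) (¬q ∘ from x∈xs)

  -- Each value f x is spread over `ys` with a Kronecker delta; after exchanging the sums, the delta
  -- collapses the sum over `xs` instead.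
  ∑-enumeration : ∀ {xs ys : List A} f → DecidableEquality A →
                  Unique xs → (∀ x → x L.∈ xs) → Unique ys → (∀ y → y L.∈ ys) →
                  ∑ xs f ≈ ∑ ys f
  ∑-enumeration {xs = xs} {ys} f _≟_ uxs xs∋ uys ys∋ = begin
    ∑[ x ← xs ] f x                              ≈⟨ ∑-cong xs (λ x → spread x ys uys ys∋) ⟨
    ∑[ x ← xs ] ∑[ y ← ys ] (⟦ x ≟ y ⟧ * f y)    ≈⟨ ∑-comm xs ys _ ⟩
    ∑[ y ← ys ] ∑[ x ← xs ] (⟦ x ≟ y ⟧ * f y)    ≈⟨ ∑-cong ys (λ y → ∑-single uxs (xs∋ y) (λ _ → off y _)) ⟩
    ∑[ y ← ys ] (⟦ y ≟ y ⟧ * f y)                ≈⟨ ∑-cong ys diagonal ⟩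
    ∑[ y ← ys ] f y                              ∎
    where
    diagonal : ∀ x → ⟦ x ≟ x ⟧ * f x ≈ f x
    diagonal x = trans (*-congʳ (⟦⟧-yes (x ≟ x) ≡.refl)) (*-identityˡ (f x))

    off : ∀ y x → x ≢ y → ⟦ x ≟ y ⟧ * f y ≈ 0#
    off y x x≢y = trans (*-congʳ (⟦⟧-no (x ≟ y) x≢y)) (zeroˡ (f y))

    spread : ∀ x ys → Unique ys → (∀ y → y L.∈ ys) → ∑[ y ← ys ] (⟦ x ≟ y ⟧ * f y) ≈ f x
    spread x ys uys ys∋ =
      trans (∑-single uys (ys∋ x) (λ {y} _ y≢x → trans (*-congʳ (⟦⟧-no (x ≟ y) (y≢x ∘ ≡.sym))) (zeroˡ (f y))))
            (diagonal x)

-- Counting with natural numbers, and sums over subsets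

module NaturalSums where
  open Summation ℕₚ.+-*-commutativeSemiring public

  ⟦⟧-complement : ∀ {P : Set} (P? : Dec P) → ⟦ ¬? P? ⟧ ℕ.+ ⟦ P? ⟧ ≡ 1
  ⟦⟧-complement (yes _) = ≡.refl
  ⟦⟧-complement (no _)  = ≡.refl

  ∑-const : ∀ {A : Set} (xs : List A) c → ∑[ _ ← xs ] c ≡ length xs ℕ.* c
  ∑-const []       c = ≡.refl
  ∑-const (_ ∷ xs) c = ≡.cong (c ℕ.+_) (∑-const xs c)

  ⟦⟧-⊎ : ∀ {P Q : Set} (P? : Dec P) (Q? : Dec Q) → ¬ (P × Q) → ⟦ P? ⊎-dec Q? ⟧ ≡ ⟦ P? ⟧ ℕ.+ ⟦ Q? ⟧
  ⟦⟧-⊎ (yes p) (yes q) excl = contradiction (p , q) excl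
  ⟦⟧-⊎ (yes _) (no _)  excl = ≡.refl
  ⟦⟧-⊎ (no _)  (yes _) excl = ≡.refl
  ⟦⟧-⊎ (no _)  (no _)  excl = ≡.refl

  length-filter-∑ : ∀ {P : Pred A p} (P? : Decidable P) xs → length (filter P? xs) ≡ ∑[ x ← xs ] ⟦ P? x ⟧
  length-filter-∑ P? []       = ≡.refl
  length-filter-∑ P? (x ∷ xs) with does (P? x)
  ... | true  = ≡.cong suc (length-filter-∑ P? xs)
  ... | false = length-filter-∑ P? xs

  term≤∑ : ∀ {xs : List A} {x} (f : A → ℕ) → x L.∈ xs → f x ℕ.≤ ∑ xs f
  term≤∑ {xs = x ∷ xs} f (here ≡.refl) = ℕₚ.m≤m+n (f x) (∑ xs f)
  term≤∑ {xs = y ∷ xs} f (there x∈xs)  = ℕₚ.≤-trans (term≤∑ f x∈xs) (ℕₚ.m≤n+m (∑ xs f) (f y))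

  ∑-subsets : ∀ n (f : Subset (suc n) → ℕ) →
              ∑ (subsets (suc n)) f ≡
              ∑[ S ← subsets n ] f (outside ∷ S) ℕ.+ ∑[ S ← subsets n ] f (inside ∷ S)
  ∑-subsets n f = ≡.trans (∑-++ (map (outside ∷_) (subsets n)) (map (inside ∷_) (subsets n)) f)
    (≡.cong₂ ℕ._+_ (∑-map (outside ∷_) (subsets n) f) (∑-map (inside ∷_) (subsets n) f))

  -- Each subset containing i is paired with the subset obtained by deleting i.
  ∑-toggle : ∀ {n} (i : Fin n) (f : Subset n → ℕ) →
             ∑[ S ← subsets n ] f S ≡ ∑[ S ← subsets n ] (⟦ i ∈? S ⟧ ℕ.* (f S ℕ.+ f (S - i)))
  ∑-toggle {suc n} Fin.zero f = begin
    ∑ (subsets (suc n)) f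
      ≡⟨ ∑-subsets n f ⟩
    ∑[ S ← subsets n ] f (outside ∷ S) ℕ.+ ∑[ S ← subsets n ] f (inside ∷ S)
      ≡⟨ ℕₚ.+-comm (∑ (subsets n) (λ S → f (outside ∷ S))) _ ⟩
    ∑[ S ← subsets n ] f (inside ∷ S) ℕ.+ ∑[ S ← subsets n ] f (outside ∷ S)
      ≡⟨ ∑-distrib-+ (subsets n) (λ S → f (inside ∷ S)) (λ S → f (outside ∷ S)) ⟨
    ∑[ S ← subsets n ] (f (inside ∷ S) ℕ.+ f (outside ∷ S))
      -- Deleting index 0 from `inside ∷ S` computes to `outside` followed by S minus the empty set,
      -- which is not S definitionally; hence `p─⊥≡p`.
      ≡⟨ ∑-cong (subsets n) (λ S → ≡.trans (≡.cong (λ T → f (inside ∷ S) ℕ.+ f (outside ∷ T)) (≡.sym (p─⊥≡p S)))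
                                           (≡.sym (ℕₚ.*-identityˡ _))) ⟩
    ∑[ S ← subsets n ] g (inside ∷ S)
      ≡⟨ ≡.cong (ℕ._+ ∑[ S ← subsets n ] g (inside ∷ S)) (∑-zero (subsets n) (λ _ → ≡.refl)) ⟨
    ∑[ S ← subsets n ] g (outside ∷ S) ℕ.+ ∑[ S ← subsets n ] g (inside ∷ S)
      ≡⟨ ∑-subsets n g ⟨
    ∑ (subsets (suc n)) g ∎
    where
    open ≡.≡-Reasoning
    g : Subset (suc n) → ℕ
    g S = ⟦ Fin.zero ∈? S ⟧ ℕ.* (f S ℕ.+ f (S - Fin.zero))
  ∑-toggle {suc n} (Fin.suc i) f = begin
    ∑ (subsets (suc n)) f
      ≡⟨ ∑-subsets n f ⟩
    ∑[ S ← subsets n ] f (outside ∷ S) ℕ.+ ∑[ S ← subsets n ] f (inside ∷ S)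
      ≡⟨ ≡.cong₂ ℕ._+_ (∑-toggle i (λ S → f (outside ∷ S))) (∑-toggle i (λ S → f (inside ∷ S))) ⟩
    ∑[ S ← subsets n ] g (outside ∷ S) ℕ.+ ∑[ S ← subsets n ] g (inside ∷ S)
      ≡⟨ ∑-subsets n g ⟨
    ∑ (subsets (suc n)) g ∎
    where
    open ≡.≡-Reasoning
    g : Subset (suc n) → ℕ
    g S = ⟦ Fin.suc i ∈? S ⟧ ℕ.* (f S ℕ.+ f (S - Fin.suc i))

∈-subsets : ∀ {n} (S : Subset n) → S L.∈ subsets n
∈-subsets []            = here ≡.refl
∈-subsets (false ∷ S) = ∈-++⁺ˡ (∈-map⁺ (outside ∷_) (∈-subsets S))
∈-subsets (true  ∷ S) = ∈-++⁺ʳ (map (outside ∷_) (subsets _)) (∈-map⁺ (inside ∷_) (∈-subsets S))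

i∉p-i : ∀ {n} (p : Subset n) i → i ∉ p - i
i∉p-i (_ ∷ p) (Fin.suc i) (Vec.there i∈) = i∉p-i p i i∈

p-i⊆p : ∀ {n} (p : Subset n) i → p - i ⊆ p
p-i⊆p p i = p─q⊆p p _

x∈p-y⇒x≢y : ∀ {n} {p : Subset n} {x y} → x ∈ p - y → x ≢ y
x∈p-y⇒x≢y {p = p} {x} x∈ ≡.refl = i∉p-i p x x∈

lookup-injective : ∀ {xs : List A} → Unique xs → ∀ i j → lookup xs i ≡ lookup xs j → i ≡ j
lookup-injective (_  ∷ _) Fin.zero    Fin.zero    _  = ≡.refl
lookup-injective (x∉ ∷ _) Fin.zero    (Fin.suc j) eq = contradiction eq (All.lookup x∉ (∈-lookup j))
lookup-injective (x∉ ∷ _) (Fin.suc i) Fin.zero    eq = contradiction (≡.sym eq) (All.lookup x∉ (∈-lookup i))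
lookup-injective (_  ∷ u) (Fin.suc i) (Fin.suc j) eq = ≡.cong Fin.suc (lookup-injective u i j eq)

-- Simple paths

-- The visited vertices are an index of the type, so that a path with enough vertices can be handed
-- to `IsCycle` as its vector; the condition in `extend` yields the injectivity required there.
data SimplePath {A : Set} (T : Rel A 0ℓ) (y : A) : ∀ {n} → A → Vec A (suc n) → Set where
  stop : SimplePath T y y (y ∷ [])
  extend : ∀ {n x z} {c : Vec A (suc n)} → T x z → x V.∉ c → SimplePath T y z c → SimplePath T y x (x ∷ c)

last-lookup : ∀ {n} (c : Vec A (suc n)) → Vec.last c ≡ Vec.lookup c (fromℕ n)
last-lookup (x ∷ [])    = ≡.refl
last-lookup (x ∷ y ∷ c) = last-lookup (y ∷ c)

chain : ∀ {A : Set} {T : Rel A 0ℓ} {n} (c : Vec A (suc n)) →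
        (∀ (j : Fin n) → T (Vec.lookup c (inject₁ j)) (Vec.lookup c (Fin.suc j))) →
        Star T (Vec.head c) (Vec.last c)
chain (x ∷ [])    adj = ε
chain (x ∷ y ∷ c) adj = adj Fin.zero ◅ chain (y ∷ c) (adj ∘ Fin.suc)

module _ {A : Set} {T : Rel A 0ℓ} {y : A} where

  path-head : ∀ {n x} {c : Vec A (suc n)} → SimplePath T y x c → Vec.head c ≡ x
  path-head stop         = ≡.refl
  path-head (extend _ _ _) = ≡.refl

  path-last : ∀ {n x} {c : Vec A (suc n)} → SimplePath T y x c → Vec.last c ≡ y
  path-last stop                                    = ≡.refl
  path-last (extend {c = _ ∷ _} _ _ p) = path-last p

  path-adjacent : ∀ {n x} {c : Vec A (suc n)} → SimplePath T y x c →
                  ∀ (j : Fin n) → T (Vec.lookup c (inject₁ j)) (Vec.lookup c (Fin.suc j))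
  path-adjacent (extend {c = _ ∷ _} t _ p) Fin.zero with ≡.refl ← path-head p = t
  path-adjacent (extend {c = _ ∷ _} _ _ p) (Fin.suc j) = path-adjacent p j

  path-injective : ∀ {n x} {c : Vec A (suc n)} → SimplePath T y x c →
                   ∀ i j → Vec.lookup c i ≡ Vec.lookup c j → i ≡ j
  path-injective p            Fin.zero    Fin.zero    _  = ≡.refl
  path-injective (extend {c = c} _ x∉c _) Fin.zero    (Fin.suc j) eq =
    contradiction (≡.subst (V._∈ c) (≡.sym eq) (V.∈-lookup j c)) x∉c
  path-injective (extend {c = c} _ x∉c _) (Fin.suc i) Fin.zero    eq =
    contradiction (≡.subst (V._∈ c) eq (V.∈-lookup i c)) x∉c
  path-injective (extend _ _ p) (Fin.suc i) (Fin.suc j) eq = ≡.cong Fin.suc (path-injective p i j eq)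

  path-suffix : ∀ {n z x} {c : Vec A (suc n)} → SimplePath T y z c → x V.∈ c →
                ∃ λ m → ∃ λ (c′ : Vec A (suc m)) → SimplePath T y x c′
  path-suffix stop           (here ≡.refl) = _ , _ , stop
  path-suffix (extend t x∉c p) (here ≡.refl) = _ , _ , extend t x∉c p
  path-suffix (extend _ _ p)   (there x∈c)   = path-suffix p x∈c

  -- Loop erasure from the far end: if the new first vertex already lies on the simple path, the
  -- loop is dropped by keeping only the suffix that starts there.
  simplify : DecidableEquality A → ∀ {x} → Star T x y →
             ∃ λ n → ∃ λ (c : Vec A (suc n)) → SimplePath T y x c
  simplify _≟_ ε = _ , _ , stop
  simplify _≟_ {x} (t ◅ w) with _ , c , p ← simplify _≟_ w with DecV._∈?_ _≟_ x c
  ... | yes x∈c = path-suffix p x∈c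
  ... | no  x∉c = _ , _ , extend t x∉c p

-- Edges, walks under deletion of an edge, and bridges

module Edges (G : Graph) where
  open Graph G hiding (V; order; degree; Reachable)

  vertices-unique : Unique vertices
  vertices-unique = Unique.map⁺ vertex-injective (Unique.allFin⁺ (order G))
    where
    vertex-injective : ∀ {i j} → vertex i ≡ vertex j → i ≡ j
    vertex-injective {i} {j} eq =
      ≡.trans (≡.sym (Inverse.strictlyInverseˡ indexing i))
              (≡.trans (≡.cong index eq) (Inverse.strictlyInverseˡ indexing j))

  edges-unique : Unique edges
  edges-unique = Unique.filter⁺ edge? (Unique.cartesianProduct⁺ vertices-unique vertices-unique)

  Edge : Set
  Edge = Fin (length edges)

  Joins : Edge → V G → V G → Set
  Joins i x y = lookup edges i ≡ (x , y) ⊎ lookup edges i ≡ (y , x)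

  joins? : ∀ i x y → Dec (Joins i x y)
  joins? i x y = ≡-dec _≟_ _≟_ (lookup edges i) (x , y) ⊎-dec ≡-dec _≟_ _≟_ (lookup edges i) (y , x)

  joins-sym : ∀ {i x y} → Joins i x y → Joins i y x
  joins-sym = Sum.swap

  edge-valid : ∀ {i x y} → lookup edges i ≡ (x , y) → (index x Fin.< index y) × Adj x y
  edge-valid {i} eq = ≡.subst (λ (x , y) → (index x Fin.< index y) × Adj x y) eq
    (proj₂ (∈-filter⁻ edge? {xs = cartesianProduct vertices vertices} (∈-lookup {xs = edges} i)))

  joins⇒adj : ∀ {i x y} → Joins i x y → Adj x y
  joins⇒adj (inj₁ eq) = proj₂ (edge-valid eq)
  joins⇒adj (inj₂ eq) = adj-sym (proj₂ (edge-valid eq))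

  joins⇒≢ : ∀ {i x y} → Joins i x y → x ≢ y
  joins⇒≢ i-xy ≡.refl = adj-irr (joins⇒adj i-xy)

  listed : ∀ {x y} → index x Fin.< index y → Adj x y → (x , y) L.∈ edges
  listed x<y x~y = ∈-filter⁺ edge? (∈-cartesianProduct⁺ (∈-vertices _) (∈-vertices _)) (x<y , x~y)

  adj⇒joins : ∀ {x y} → Adj x y → ∃ λ i → Joins i x y
  adj⇒joins {x} {y} x~y with Finₚ.<-cmp (index x) (index y)
  ... | tri< x<y _ _ = _ , inj₁ (≡.sym (Anyₚ.lookup-index (listed x<y x~y)))
  ... | tri≈ _ x≡y _ = contradiction (≡.subst (Adj x) (≡.sym (index-injective x≡y)) x~y) adj-irr
  ... | tri> _ _ y<x = _ , inj₂ (≡.sym (Anyₚ.lookup-index (listed y<x (adj-sym x~y))))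

  joins-unique : ∀ {i j x y} → Joins i x y → Joins j x y → i ≡ j
  joins-unique (inj₁ p) (inj₁ q) = lookup-injective edges-unique _ _ (≡.trans p (≡.sym q))
  joins-unique (inj₂ p) (inj₂ q) = lookup-injective edges-unique _ _ (≡.trans p (≡.sym q))
  -- No edge is listed in both orientations, because the first endpoint has the smaller index.
  joins-unique (inj₁ p) (inj₂ q) = contradiction (proj₁ (edge-valid p)) (Finₚ.<-asym (proj₁ (edge-valid q)))
  joins-unique (inj₂ p) (inj₁ q) = contradiction (proj₁ (edge-valid p)) (Finₚ.<-asym (proj₁ (edge-valid q)))

  joins-ends : ∀ {i x y u v} → Joins i x y → Joins i u v → (u ≡ x × v ≡ y) ⊎ (u ≡ y × v ≡ x)
  joins-ends (inj₁ p) (inj₁ q) = inj₁ (≡.sym (,-injectiveˡ r) , ≡.sym (,-injectiveʳ r))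
    where r = ≡.trans (≡.sym p) q
  joins-ends (inj₂ p) (inj₂ q) = inj₁ (≡.sym (,-injectiveʳ r) , ≡.sym (,-injectiveˡ r))
    where r = ≡.trans (≡.sym p) q
  joins-ends (inj₁ p) (inj₂ q) = inj₂ (≡.sym (,-injectiveʳ r) , ≡.sym (,-injectiveˡ r))
    where r = ≡.trans (≡.sym p) q
  joins-ends (inj₂ p) (inj₁ q) = inj₂ (≡.sym (,-injectiveˡ r) , ≡.sym (,-injectiveʳ r))
    where r = ≡.trans (≡.sym p) q

  joins-other : ∀ {i x y z} → Joins i x y → Joins i x z → y ≡ z
  joins-other i-xy i-xz with joins-ends i-xy i-xz
  ... | inj₁ (_ , z≡y)   = ≡.sym z≡y
  ... | inj₂ (x≡y , z≡x) = contradiction x≡y (joins⇒≢ i-xy)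

  infix 4 _⊢_~_ _⊢_~?_

  _⊢_~_ : Subset (length edges) → V G → V G → Set
  S ⊢ x ~ y = Reachable (spanning G S) x y

  _⊢_~?_ : ∀ S x y → Dec (S ⊢ x ~ y)
  S ⊢ x ~? y = reachable? (spanning G S) x y

  ~-edge : ∀ {S i x y} → i ∈ S → Joins i x y → S ⊢ x ~ y
  ~-edge i∈S i-xy = (_ , i∈S , i-xy) ◅ ε

  ~-sym : ∀ {S x y} → S ⊢ x ~ y → S ⊢ y ~ x
  ~-sym = Star.reverse (λ (i , i∈S , i-xy) → i , i∈S , joins-sym {i} i-xy)

  ~-mono : ∀ {S T x y} → S ⊆ T → S ⊢ x ~ y → T ⊢ x ~ y
  ~-mono S⊆T = Star.map λ (i , i∈S , i-xy) → i , S⊆T i∈S , i-xy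

  -- A walk can be shortened until it crosses `i` at most once: what lies between its first and its
  -- last crossing either returns to the same end of `i` or amounts to a single crossing. The
  -- outcomes are no crossing and one crossing in either direction.
  ~-split : ∀ {S i a b x y} → Joins i a b → S ⊢ x ~ y →
            (S - i ⊢ x ~ y) ⊎ (S - i ⊢ x ~ a × S - i ⊢ b ~ y) ⊎ (S - i ⊢ x ~ b × S - i ⊢ a ~ y)
  ~-split i-ab ε = inj₁ ε
  ~-split {S} {i} i-ab ((j , j∈S , j-xz) ◅ z~y) with j Finₚ.≟ i | ~-split i-ab z~y
  ... | no j≢i     | r = Sum.map (x~z ◅◅_) (Sum.map (λ (p , q) → x~z ◅◅ p , q) (λ (p , q) → x~z ◅◅ p , q)) r
    where x~z = ~-edge (x∈p∧x≢y⇒x∈p-y j∈S j≢i) j-xz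
  ... | yes ≡.refl | r with joins-ends i-ab j-xz | r
  ... | inj₁ (≡.refl , ≡.refl) | inj₁ b~y              = inj₂ (inj₁ (ε , b~y))
  ... | inj₁ (≡.refl , ≡.refl) | inj₂ (inj₁ (_ , b~y)) = inj₂ (inj₁ (ε , b~y))
  ... | inj₁ (≡.refl , ≡.refl) | inj₂ (inj₂ (_ , a~y)) = inj₁ a~y
  ... | inj₂ (≡.refl , ≡.refl) | inj₁ a~y              = inj₂ (inj₂ (ε , a~y))
  ... | inj₂ (≡.refl , ≡.refl) | inj₂ (inj₁ (_ , b~y)) = inj₁ b~y
  ... | inj₂ (≡.refl , ≡.refl) | inj₂ (inj₂ (_ , a~y)) = inj₂ (inj₂ (ε , a~y))

  -- The working form of acyclicity: it speaks of one edge at a time, so it can be followed through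
  -- deleting and restoring an edge.
  Bridges : Subset (length edges) → Set
  Bridges S = ∀ {i x y} → i ∈ S → Joins i x y → ¬ S - i ⊢ x ~ y

  -- A detour around `i`, made simple, closes up with `i` to a cycle. Since `IsCycle` asks for at
  -- least three vertices, the short detours are excluded separately: one without edges would make
  -- `i` a loop, and one with a single edge would be `i` itself.
  acyclic⇒bridges : ∀ {S} → Acyclic (spanning G S) → Bridges S
  acyclic⇒bridges {S} acyclic {i} {x} {y} i∈S i-xy x~y with simplify _≟_ x~y
  ... | _ , _ , stop                            = joins⇒≢ i-xy ≡.refl
  ... | _ , _ , extend (j , j∈ , j-xy) _ stop     = x∈p-y⇒x≢y j∈ (joins-unique j-xy i-xy)
  ... | suc (suc l) , c , p@(extend _ _ (extend _ _ _)) = acyclic (l , c , path-injective p , adjacent , closing)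
    where
    adjacent : ∀ j → Graph.Adj (spanning G S) (Vec.lookup c (inject₁ j)) (Vec.lookup c (Fin.suc j))
    adjacent j with k , k∈ , k-uv ← path-adjacent p j = k , p-i⊆p S i k∈ , k-uv
    closing : Graph.Adj (spanning G S) (Vec.last c) (Vec.head c)
    closing = ≡.subst₂ (Graph.Adj (spanning G S)) (≡.sym (path-last p)) (≡.sym (path-head p))
                       (i , i∈S , joins-sym {i} i-xy)

  -- The remaining edges of a cycle form a detour around its closing edge, once it is known that the
  -- closing edge is not among them.
  bridges⇒acyclic : ∀ {S} → Bridges S → Acyclic (spanning G S)
  bridges⇒acyclic {S} bridges (l , c@(_ ∷ _) , injective , adjacent , i , i∈S , i-closing) =
    bridges i∈S (joins-sym {i} i-closing) (chain c detour)
    where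
    detour : ∀ j → Graph.Adj (spanning G (S - i)) (Vec.lookup c (inject₁ j)) (Vec.lookup c (Fin.suc j))
    detour j with k , k∈S , k-uv ← adjacent j = k , x∈p∧x≢y⇒x∈p-y k∈S k≢i , k-uv
      where
      k≢i : k ≢ i
      k≢i ≡.refl with joins-ends i-closing k-uv
      ... | inj₁ (_ , v≡head) with () ← injective (Fin.suc j) Fin.zero v≡head
      -- Here the step `j` would run from the first vertex to the last, so its endpoints would have
      -- the indices 0 and 1 = 2 + l. This is where a cycle of length 2 has to be excluded.
      ... | inj₂ (u≡head , v≡last) =
        first≢last j (injective (inject₁ j) Fin.zero u≡head)
                     (injective (Fin.suc j) (fromℕ (2 ℕ.+ l)) (≡.trans v≡last (last-lookup c)))
        where
        first≢last : ∀ (j : Fin (2 ℕ.+ l)) → inject₁ j ≡ Fin.zero → Fin.suc j ≢ fromℕ (2 ℕ.+ l)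
        first≢last Fin.zero _ ()

-- Graphs with two components

module TwoComponents (H : Graph) where

  two-of-two : ∀ (i j k : Fin 2) → i ≢ j → k ≡ i ⊎ k ≡ j
  two-of-two Fin.zero              Fin.zero              k                     i≢j = contradiction ≡.refl i≢j
  two-of-two (Fin.suc Fin.zero)    (Fin.suc Fin.zero)    k                     i≢j = contradiction ≡.refl i≢j
  two-of-two Fin.zero              (Fin.suc Fin.zero)    Fin.zero              i≢j = inj₁ ≡.refl
  two-of-two Fin.zero              (Fin.suc Fin.zero)    (Fin.suc Fin.zero)    i≢j = inj₂ ≡.refl
  two-of-two (Fin.suc Fin.zero)    Fin.zero              Fin.zero              i≢j = inj₂ ≡.refl
  two-of-two (Fin.suc Fin.zero)    Fin.zero              (Fin.suc Fin.zero)    i≢j = inj₁ ≡.refl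

  reach-sym : ∀ {x y} → Reachable H x y → Reachable H y x
  reach-sym = Star.reverse (Graph.adj-sym H)

  -- The representatives that x and y meet are different, hence they are the only two, and v meets
  -- one of them.
  cover : ∀ {x y} → HasComponents H 2 → ¬ Reachable H x y → ∀ v → Reachable H v x ⊎ Reachable H v y
  cover {x} {y} (t , _ , meets) x≁y v
    with i , x~i ← meets x | j , y~j ← meets y | k , v~k ← meets v
    with two-of-two i j k (λ { ≡.refl → x≁y (x~i ◅◅ reach-sym y~j) })
  ... | inj₁ ≡.refl = inj₁ (v~k ◅◅ reach-sym x~i)
  ... | inj₂ ≡.refl = inj₂ (v~k ◅◅ reach-sym y~j)

  hasTwoComponents : ∀ {x y} → ¬ Reachable H x y → (∀ v → Reachable H v x ⊎ Reachable H v y) →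
                     HasComponents H 2
  hasTwoComponents {x} {y} x≁y covered = (x ∷ y ∷ []) , distinct , meets
    where
    distinct : ∀ i j → Reachable H (Vec.lookup (x ∷ y ∷ []) i) (Vec.lookup (x ∷ y ∷ []) j) → i ≡ j
    distinct Fin.zero           Fin.zero           _   = ≡.refl
    distinct Fin.zero           (Fin.suc Fin.zero) x~y = contradiction x~y x≁y
    distinct (Fin.suc Fin.zero) Fin.zero           y~x = contradiction (reach-sym y~x) x≁y
    distinct (Fin.suc Fin.zero) (Fin.suc Fin.zero) _   = ≡.refl
    meets : ∀ v → ∃ λ i → Reachable H v (Vec.lookup (x ∷ y ∷ []) i)
    meets v = Sum.[ (λ v~x → Fin.zero , v~x) , (λ v~y → Fin.suc Fin.zero , v~y) ] (covered v)

-- Cutting and joining trees along an edge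

module Forests (G : Graph) where
  open Graph G hiding (V; order; degree; Reachable)
  open Edges G

  Tree : Subset (length edges) → Set
  Tree T = IsTree (spanning G T)

  tree? : ∀ T → Dec (Tree T)
  tree? T = isTree? (spanning G T)

  tree⇒bridges : ∀ {T} → Tree T → Bridges T
  tree⇒bridges (_ , acyclic) = acyclic⇒bridges acyclic

  separated : ∀ {x y S} → Separating G x y S → ¬ S ⊢ x ~ y
  separated (_ , _ , x≁y) = x≁y

  separating-cover : ∀ {x y S} → Separating G x y S → ∀ v → S ⊢ v ~ x ⊎ S ⊢ v ~ y
  separating-cover {S = S} (_ , two , x≁y) = TwoComponents.cover (spanning G S) two x≁y

  separating-sym : ∀ {x y S} → Separating G x y S → Separating G y x S
  separating-sym (acyclic , two , x≁y) = acyclic , two , x≁y ∘ ~-sym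

  separating-move : ∀ {x y u S} → S ⊢ u ~ x → Separating G x y S → Separating G u y S
  separating-move u~x (acyclic , two , x≁y) = acyclic , two , λ u~y → x≁y (~-sym u~x ◅◅ u~y)

  -- Restoring `i` links the component of x and w to that of z and y, and `i` is a bridge because x
  -- and z were separated. A detour around another edge j either avoids `i`, against the acyclicity
  -- of the forest, or crosses it; in the latter case its two pieces and j together link x to z
  -- without `i`.
  joined-tree : ∀ {T i x z w y} → i ∈ T → Joins i x z →
                Separating G w y (T - i) → T - i ⊢ x ~ w → T - i ⊢ z ~ y → Tree T
  joined-tree {T} {i} {x} {z} {w} {y} i∈T i-xz sep x~w z~y = connected , bridges⇒acyclic bridges
    where
    x≁z : ¬ T - i ⊢ x ~ z
    x≁z x~z = separated sep (~-sym x~w ◅◅ x~z ◅◅ z~y)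

    toX : ∀ v → T ⊢ v ~ x
    toX v with separating-cover sep v
    ... | inj₁ v~w = ~-mono (p-i⊆p T i) (v~w ◅◅ ~-sym x~w)
    ... | inj₂ v~y = ~-mono (p-i⊆p T i) (v~y ◅◅ ~-sym z~y) ◅◅ ~-sym (~-edge i∈T i-xz)

    connected : Connected (spanning G T)
    connected u v = toX u ◅◅ ~-sym (toX v)

    bridges : Bridges T
    bridges {j} {u} {v} j∈T j-uv u~v with j Finₚ.≟ i
    ... | yes ≡.refl =
      Sum.[ (λ { (≡.refl , ≡.refl) → x≁z u~v }) , (λ { (≡.refl , ≡.refl) → x≁z (~-sym u~v) }) ] (joins-ends i-xz j-uv)
    ... | no j≢i = Sum.[ acyclic⇒bridges (proj₁ sep) j∈T-i j-uv ∘ swap ,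
      Sum.[ (λ (u~x , z~v) → x≁z (~-sym (lift u~x) ◅◅ ~-edge j∈T-i j-uv ◅◅ ~-sym (lift z~v))) ,
            (λ (u~z , x~v) → x≁z (lift x~v ◅◅ ~-sym (~-edge j∈T-i j-uv) ◅◅ lift u~z)) ] ] (~-split i-xz u~v)
      where
      j∈T-i = x∈p∧x≢y⇒x∈p-y j∈T j≢i
      swap : ∀ {a b} → T - j - i ⊢ a ~ b → T - i - j ⊢ a ~ b
      swap {a} {b} = ≡.subst (_⊢ a ~ b) (p─x─y≡p─y─x T j i)
      lift : ∀ {a b} → T - j - i ⊢ a ~ b → T - i ⊢ a ~ b
      lift a~b = ~-mono (p-i⊆p (T - i) j) (swap a~b)

  bridges-mono : ∀ {S T} → S ⊆ T → Bridges T → Bridges S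
  bridges-mono {S} {T} S⊆T bridges {i} i∈S i-xy x~y =
    bridges (S⊆T i∈S) i-xy (~-mono (λ j∈ → x∈p∧x≢y⇒x∈p-y (S⊆T (p-i⊆p S i j∈)) (x∈p-y⇒x≢y j∈)) x~y)

  cut-cover : ∀ {T i x z} → Tree T → Joins i x z → ∀ v → T - i ⊢ v ~ x ⊎ T - i ⊢ v ~ z
  cut-cover {x = x} (connected , _) i-xz v with ~-split i-xz (connected v x)
  ... | inj₁ v~x              = inj₁ v~x
  ... | inj₂ (inj₁ (v~x , _)) = inj₁ v~x
  ... | inj₂ (inj₂ (v~z , _)) = inj₂ v~z

  -- The converse of `joined-tree`. Deleting `i` leaves the side of x and the side of z; y lies with
  -- z and w does not, so w lies with x.
  cut-tree : ∀ {T i x z w y} → i ∈ T → Joins i x z → Tree T →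
             T - i ⊢ z ~ y → ¬ T - i ⊢ z ~ w → Separating G w y (T - i) × T - i ⊢ x ~ w
  cut-tree {T} {i} {x} {z} {w} {y} i∈T i-xz tree z~y z≁w =
    (bridges⇒acyclic (bridges-mono (p-i⊆p T i) (tree⇒bridges tree)) ,
     TwoComponents.hasTwoComponents (spanning G (T - i)) w≁y covered , w≁y) , ~-sym w~x
    where
    w~x : T - i ⊢ w ~ x
    w~x with cut-cover tree i-xz w
    ... | inj₁ w~x = w~x
    ... | inj₂ w~z = contradiction (~-sym w~z) z≁w
    w≁y : ¬ T - i ⊢ w ~ y
    w≁y w~y = z≁w (z~y ◅◅ ~-sym w~y)
    covered : ∀ v → T - i ⊢ v ~ w ⊎ T - i ⊢ v ~ y
    covered v = Sum.map (_◅◅ ~-sym w~x) (_◅◅ z~y) (cut-cover tree i-xz v)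

  module _ {T} (tree : Tree T) where

    -- Walks in `T` none of whose edges touches `x`. They survive the deletion of any edge at `x`,
    -- so the effects of deleting two different edges at `x` can be compared. The empty walk at `x`
    -- itself also qualifies and has to be ruled out where it arises.
    Avoiding : V G → V G → V G → Set
    Avoiding x = Star (λ a b → Graph.Adj (spanning G T) a b × a ≢ x × b ≢ x)

    avoiding-deleted : ∀ {i x z a b} → Joins i x z → Avoiding x a b → T - i ⊢ a ~ b
    avoiding-deleted {i} {x} i-xz = Star.map λ { ((j , j∈T , j-ab) , a≢x , b≢x) →
      j , x∈p∧x≢y⇒x∈p-y j∈T (λ { ≡.refl → Sum.[ a≢x ∘ proj₁ , b≢x ∘ proj₂ ] (joins-ends i-xz j-ab) }) , j-ab }

    -- A visit to `x` would leave a remainder of the walk leading from `x` to `b`.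
    deleted-avoiding : ∀ {i x a b} → ¬ T - i ⊢ x ~ b → T - i ⊢ a ~ b → Avoiding x a b
    deleted-avoiding x≁b ε = ε
    deleted-avoiding {i} {x} {a} x≁b s@((j , j∈ , j-ac) ◅ w) =
      ((j , p-i⊆p T i j∈ , j-ac) , (λ { ≡.refl → x≁b s }) , (λ { ≡.refl → x≁b w })) ◅ deleted-avoiding x≁b w

    -- Decomposition at the last visit to x, found by recursion from the far end: whatever follows
    -- the edge by which x is left for the last time avoids x.
    avoid-or-leave : ∀ {x y a} → x ≢ y → T ⊢ a ~ y →
                     Avoiding x a y ⊎ ∃₂ λ i z → i ∈ T × Joins i x z × Avoiding x z y
    avoid-or-leave x≢y ε = inj₁ ε
    avoid-or-leave {x} {a = a} x≢y (_◅_ {j = b} (i , i∈T , i-ab) w) with avoid-or-leave x≢y w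
    ... | inj₂ exit = inj₂ exit
    ... | inj₁ avoiding with a ≟ x | b ≟ x
    ...   | yes ≡.refl | _          = inj₂ (i , b , i∈T , i-ab , avoiding)
    ...   | no a≢x     | no b≢x     = inj₁ (((i , i∈T , i-ab) , a≢x , b≢x) ◅ avoiding)
    -- The rest of the walk starts at x and yet avoids it, so it is empty and ends at x, against x ≢
    -- y.
    ...   | no a≢x     | yes ≡.refl with avoiding
    ...     | ε                     = contradiction ≡.refl x≢y
    ...     | (_ , x≢x , _) ◅ _     = contradiction ≡.refl x≢x

    -- A walk from x to another vertex cannot avoid x, so it has a last departure from x. Together
    -- with `exit-unique` this identifies `i` as the first edge of the tree path from x to y.
    exit-exists : ∀ {x y} → x ≢ y → ∃₂ λ i z → i ∈ T × Joins i x z × T - i ⊢ z ~ y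
    exit-exists {x} {y} x≢y with avoid-or-leave x≢y (proj₁ tree x y)
    ... | inj₂ (i , z , i∈T , i-xz , avoiding) = i , z , i∈T , i-xz , avoiding-deleted i-xz avoiding
    ... | inj₁ ε                     = contradiction ≡.refl x≢y
    ... | inj₁ ((_ , x≢x , _) ◅ _) = contradiction ≡.refl x≢x

    exit-nontrivial : ∀ {i x y z} → i ∈ T → Joins i x z → T - i ⊢ z ~ y → x ≢ y
    exit-nontrivial i∈T i-xz z~y ≡.refl = tree⇒bridges tree i∈T i-xz (~-sym z~y)

    -- The walk from z′ to y avoids x, hence it survives the deletion of `i`. If `j` differed from
    -- `i`, then x, z′, y and z would be linked without `i`, which is a bridge.
    exit-unique : ∀ {i j x y z z′} → i ∈ T → Joins i x z → T - i ⊢ z ~ y →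
                  j ∈ T → Joins j x z′ → T - j ⊢ z′ ~ y → i ≡ j
    exit-unique {i} {j} {x} {y} {z} {z′} i∈T i-xz z~y j∈T j-xz′ z′~y with i Finₚ.≟ j
    ... | yes i≡j = i≡j
    ... | no i≢j = contradiction
      (~-edge (x∈p∧x≢y⇒x∈p-y j∈T (i≢j ∘ ≡.sym)) j-xz′ ◅◅ avoiding-deleted i-xz z′-avoiding ◅◅ ~-sym z~y)
      (tree⇒bridges tree i∈T i-xz)
      where
      z′-avoiding : Avoiding x z′ y
      z′-avoiding = deleted-avoiding (λ x~y → tree⇒bridges tree j∈T j-xz′ (x~y ◅◅ ~-sym z′~y)) z′~y

-- Forest counts and the Laplace equation they satisfy

module Counting (G : Graph) where
  open NaturalSums
  open Graph G hiding (V; order; degree; Reachable)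
  open Edges G
  open Forests G
  open ≡.≡-Reasoning

  forests : List (Subset (length edges))
  forests = subsets (length edges)

  -- Each neighbour of x comes with the edge leading to it: the tree counts delete that edge,
  -- whereas the Laplacian needs only the neighbour.
  darts : V G → List (V G × Edge)
  darts x = filter (λ (z , i) → joins? i x z) (cartesianProduct vertices (allFin (length edges)))

  darts-unique : ∀ x → Unique (darts x)
  darts-unique x = Unique.filter⁺ (λ (z , i) → joins? i x z)
    (Unique.cartesianProduct⁺ vertices-unique (Unique.allFin⁺ (length edges)))

  dart⁺ : ∀ {x z i} → Joins i x z → (z , i) L.∈ darts x
  dart⁺ {x} {z} {i} = ∈-filter⁺ (λ (z , i) → joins? i x z) (∈-cartesianProduct⁺ (∈-vertices z) (∈-allFin i))

  dart⁻ : ∀ {x z i} → (z , i) L.∈ darts x → Joins i x z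
  dart⁻ {x} d = proj₂ (∈-filter⁻ (λ (z , i) → joins? i x z)
    {xs = cartesianProduct vertices (allFin (length edges))} d)

  ∑-darts : ∀ x (f : V G → ℕ) → ∑[ z ← vertices ] (⟦ adj? x z ⟧ ℕ.* f z) ≡ ∑[ d ← darts x ] f (proj₁ d)
  ∑-darts x f = begin
    ∑[ z ← vertices ] (⟦ adj? x z ⟧ ℕ.* f z)
      ≡⟨ ∑-cong vertices (λ z → ≡.cong (ℕ._* f z) (edge-of z)) ⟨
    ∑[ z ← vertices ] (∑[ i ← allFin _ ] ⟦ joins? i x z ⟧ ℕ.* f z)
      ≡⟨ ∑-cong vertices (λ z → *-distribʳ-∑ (allFin _) (f z) (λ i → ⟦ joins? i x z ⟧)) ⟩
    ∑[ z ← vertices ] ∑[ i ← allFin _ ] (⟦ joins? i x z ⟧ ℕ.* f z)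
      ≡⟨ ∑-cartesianProduct vertices (allFin _) (λ (z , i) → ⟦ joins? i x z ⟧ ℕ.* f z) ⟨
    ∑[ d ← cartesianProduct vertices (allFin _) ] (⟦ joins? (proj₂ d) x (proj₁ d) ⟧ ℕ.* f (proj₁ d))
      ≡⟨ ∑-filter (λ (z , i) → joins? i x z) (cartesianProduct vertices (allFin _)) (f ∘ proj₁) ⟨
    ∑[ d ← darts x ] f (proj₁ d) ∎
    where
    edge-of : ∀ z → ∑[ i ← allFin _ ] ⟦ joins? i x z ⟧ ≡ ⟦ adj? x z ⟧
    edge-of z = ∑-unique (λ i → joins? i x z) (Unique.allFin⁺ _) (λ _ _ → joins-unique) (adj? x z)
      (λ x~z → let i , i-xz = adj⇒joins x~z in i , ∈-allFin i , i-xz) (λ _ → joins⇒adj)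

  degree-darts : ∀ x c → degree G x ℕ.* c ≡ ∑[ d ← darts x ] c
  degree-darts x c = begin
    degree G x ℕ.* c                            ≡⟨ ≡.cong (ℕ._* c) (length-filter-∑ (adj? x) vertices) ⟩
    ∑[ z ← vertices ] ⟦ adj? x z ⟧ ℕ.* c        ≡⟨ *-distribʳ-∑ vertices c (λ z → ⟦ adj? x z ⟧) ⟩
    ∑[ z ← vertices ] (⟦ adj? x z ⟧ ℕ.* c)      ≡⟨ ∑-darts x (λ _ → c) ⟩
    ∑[ d ← darts x ] c                          ∎

  -- K x w y is F(xw∣y), and L x w z y is F(xw∣zy).
  Together : V G → V G → V G → Subset (length edges) → Set
  Together x w y S = Separating G w y S × S ⊢ x ~ w

  together? : ∀ x w y S → Dec (Together x w y S)
  together? x w y S = separating? G w y S ×-dec (S ⊢ x ~? w)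

  K : V G → V G → V G → ℕ
  K x w y = ∑[ S ← forests ] ⟦ together? x w y S ⟧

  Split : V G → V G → V G → V G → Subset (length edges) → Set
  Split x w z y S = Separating G w y S × S ⊢ x ~ w × S ⊢ z ~ y

  split? : ∀ x w z y S → Dec (Split x w z y S)
  split? x w z y S = separating? G w y S ×-dec ((S ⊢ x ~? w) ×-dec (S ⊢ z ~? y))

  L : V G → V G → V G → V G → ℕ
  L x w z y = ∑[ S ← forests ] ⟦ split? x w z y S ⟧

  L-swap : ∀ x w z y → L x w z y ≡ L z y x w
  L-swap x w z y = ∑-cong forests λ S → ⟦⟧-cong (split? x w z y S) (split? z y x w S) swap swap
    where
    swap : ∀ {x w z y S} → Split x w z y S → Split z y x w S
    swap {S = S} (sep , x~w , z~y) = separating-sym {S = S} sep , z~y , x~w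

  K-exchange : ∀ x z w y → K x w y ℕ.+ L z w x y ≡ K z w y ℕ.+ L x w z y
  K-exchange x z w y = begin
    K x w y ℕ.+ L z w x y
      ≡⟨ ∑-distrib-+ forests (λ S → ⟦ together? x w y S ⟧) (λ S → ⟦ split? z w x y S ⟧) ⟨
    ∑[ S ← forests ] (⟦ together? x w y S ⟧ ℕ.+ ⟦ split? z w x y S ⟧)
      ≡⟨ ∑-cong forests pointwise ⟩
    ∑[ S ← forests ] (⟦ together? z w y S ⟧ ℕ.+ ⟦ split? x w z y S ⟧)
      ≡⟨ ∑-distrib-+ forests (λ S → ⟦ together? z w y S ⟧) (λ S → ⟦ split? x w z y S ⟧) ⟩
    K z w y ℕ.+ L x w z y ∎
    where
    cases : ∀ {S} (sep? : Dec (Separating G w y S))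
            (xw? : Dec (S ⊢ x ~ w)) (xy? : Dec (S ⊢ x ~ y)) (zw? : Dec (S ⊢ z ~ w)) (zy? : Dec (S ⊢ z ~ y)) →
            ⟦ sep? ×-dec xw? ⟧ ℕ.+ ⟦ sep? ×-dec (zw? ×-dec xy?) ⟧ ≡
            ⟦ sep? ×-dec zw? ⟧ ℕ.+ ⟦ sep? ×-dec (xw? ×-dec zy?) ⟧
    cases (no _)    _         _         _         _         = ≡.refl
    cases (yes sep) (no x≁w)  (no x≁y)  _         _         = contradiction (separating-cover sep x) Sum.[ x≁w , x≁y ]
    cases (yes sep) (yes x~w) (yes x~y) _         _         = contradiction (~-sym x~w ◅◅ x~y) (separated sep)
    cases (yes sep) _         _         (no z≁w)  (no z≁y)  = contradiction (separating-cover sep z) Sum.[ z≁w , z≁y ]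
    cases (yes sep) _         _         (yes z~w) (yes z~y) = contradiction (~-sym z~w ◅◅ z~y) (separated sep)
    -- Each of x and z now lies with exactly one of w and y. Both sides are 1 in the first three
    -- positions and 0 when x and z both lie with y.
    cases (yes _)   (yes _)   (no _)    (yes _)   (no _)    = ≡.refl
    cases (yes _)   (yes _)   (no _)    (no _)    (yes _)   = ≡.refl
    cases (yes _)   (no _)    (yes _)   (yes _)   (no _)    = ≡.refl
    cases (yes _)   (no _)    (yes _)   (no _)    (yes _)   = ≡.refl

    pointwise : ∀ S → ⟦ together? x w y S ⟧ ℕ.+ ⟦ split? z w x y S ⟧ ≡
                      ⟦ together? z w y S ⟧ ℕ.+ ⟦ split? x w z y S ⟧
    pointwise S = cases (separating? G w y S) (S ⊢ x ~? w) (S ⊢ x ~? y) (S ⊢ z ~? w) (S ⊢ z ~? y)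

  -- In a tree where `i` joins x to z, this says that `i` is the first edge on the way from x to y
  -- but not on the way from x to w. The vertex x enters only through `i`.
  Cut : Subset (length edges) → Edge → V G → V G → V G → Set
  Cut T i z y w = i ∈ T × T - i ⊢ z ~ y × ¬ T - i ⊢ z ~ w

  cut? : ∀ T i z y w → Dec (Cut T i z y w)
  cut? T i z y w = (i ∈? T) ×-dec ((T - i ⊢ z ~? y) ×-dec ¬? (T - i ⊢ z ~? w))

  -- `∑-toggle` pairs a set T containing `i` with T - i. The set T is never split, since `i` links x
  -- to z and thereby w to y; and T - i is split exactly when T is a tree cut by `i`, by
  -- `joined-tree` and `cut-tree`.
  L-trees : ∀ {i x z} → Joins i x z → ∀ w y →
            L x w z y ≡ ∑[ T ← forests ] (⟦ tree? T ⟧ ℕ.* ⟦ cut? T i z y w ⟧)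
  L-trees {i} {x} {z} i-xz w y =
    ≡.trans (∑-toggle i (λ S → ⟦ split? x w z y S ⟧)) (∑-cong forests toggled)
    where
    toggled : ∀ T → ⟦ i ∈? T ⟧ ℕ.* (⟦ split? x w z y T ⟧ ℕ.+ ⟦ split? x w z y (T - i) ⟧) ≡
                    ⟦ tree? T ⟧ ℕ.* ⟦ cut? T i z y w ⟧
    toggled T = by-cases (i ∈? T)
      where
      exits? = (T - i ⊢ z ~? y) ×-dec ¬? (T - i ⊢ z ~? w)
      by-cases : (d : Dec (i ∈ T)) → ⟦ d ⟧ ℕ.* (⟦ split? x w z y T ⟧ ℕ.+ ⟦ split? x w z y (T - i) ⟧) ≡
                                     ⟦ tree? T ⟧ ℕ.* ⟦ d ×-dec exits? ⟧
      by-cases (no _)    = ≡.sym (ℕₚ.*-zeroʳ ⟦ tree? T ⟧)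
      by-cases (yes i∈T) = begin
        1 ℕ.* (⟦ split? x w z y T ⟧ ℕ.+ ⟦ split? x w z y (T - i) ⟧)
          ≡⟨ ℕₚ.*-identityˡ _ ⟩
        ⟦ split? x w z y T ⟧ ℕ.+ ⟦ split? x w z y (T - i) ⟧
          ≡⟨ ≡.cong (ℕ._+ ⟦ split? x w z y (T - i) ⟧) (⟦⟧-no (split? x w z y T) joined) ⟩
        ⟦ split? x w z y (T - i) ⟧
          ≡⟨ ⟦⟧-cong (split? x w z y (T - i)) (tree? T ×-dec exits?) to from ⟩
        ⟦ tree? T ×-dec exits? ⟧
          ≡⟨ ⟦⟧-× (tree? T) exits? (tree? T ×-dec exits?) ⟩
        ⟦ tree? T ⟧ ℕ.* ⟦ exits? ⟧ ∎
        where
        joined : ¬ Split x w z y T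
        joined (sep , x~w , z~y) = separated sep (~-sym x~w ◅◅ ~-edge i∈T i-xz ◅◅ z~y)
        to : Split x w z y (T - i) → Tree T × T - i ⊢ z ~ y × ¬ T - i ⊢ z ~ w
        to (sep , x~w , z~y) =
          joined-tree i∈T i-xz sep x~w z~y , z~y , λ z~w → separated sep (~-sym z~w ◅◅ z~y)
        from : Tree T × T - i ⊢ z ~ y × ¬ T - i ⊢ z ~ w → Split x w z y (T - i)
        from (tree , z~y , z≁w) = let sep , x~w = cut-tree i∈T i-xz tree z~y z≁w in sep , x~w , z~y

  module _ {T} (tree : Tree T) where

    exit? : ∀ y d → Dec (proj₂ d ∈ T × T - proj₂ d ⊢ proj₁ d ~ y)
    exit? y (z , i) = (i ∈? T) ×-dec (T - i ⊢ z ~? y)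

    -- The exit towards y is the first edge of the tree path from x; it exists uniquely, except that
    -- the path from x to itself has no first edge.
    ∑-exits : ∀ x y → ∑[ d ← darts x ] ⟦ exit? y d ⟧ ≡ ⟦ ¬? (x ≟ y) ⟧
    ∑-exits x y = ∑-unique (exit? y) (darts-unique x) unique (¬? (x ≟ y)) exists
      (λ d (i∈T , z~y) → exit-nontrivial tree i∈T (dart⁻ d) z~y)
      where
      exists : x ≢ y → ∃ λ d → d L.∈ darts x × proj₂ d ∈ T × T - proj₂ d ⊢ proj₁ d ~ y
      exists x≢y with i , z , i∈T , i-xz , z~y ← exit-exists tree x≢y = (z , i) , dart⁺ i-xz , i∈T , z~y
      unique : ∀ {d e} → d L.∈ darts x → e L.∈ darts x →
               proj₂ d ∈ T × T - proj₂ d ⊢ proj₁ d ~ y → proj₂ e ∈ T × T - proj₂ e ⊢ proj₁ e ~ y → d ≡ e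
      unique d e (i∈T , z~y) (j∈T , z′~y)
        with ≡.refl ← exit-unique tree i∈T (dart⁻ d) z~y j∈T (dart⁻ e) z′~y =
        ≡.cong (_, _) (joins-other (dart⁻ d) (dart⁻ e))

    -- An exit towards y that is not a cut is also an exit towards w, and the number of common exits
    -- is symmetric in y and w. It therefore cancels, and the two cut counts differ by as much as
    -- the numbers of exits: 1 towards y, and 1 or 0 towards w.
    ∑-cuts : ∀ {x y} w → x ≢ y →
             ∑[ d ← darts x ] ⟦ cut? T (proj₂ d) (proj₁ d) y w ⟧ ≡
             ∑[ d ← darts x ] ⟦ cut? T (proj₂ d) (proj₁ d) w y ⟧ ℕ.+ ⟦ x ≟ w ⟧
    ∑-cuts {x} {y} w x≢y = ℕₚ.+-cancelʳ-≡ (both y w) _ _ (begin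
      cuts y w ℕ.+ both y w                ≡⟨ cut-or-both y w ⟩
      ⟦ ¬? (x ≟ y) ⟧                       ≡⟨ ⟦⟧-yes (¬? (x ≟ y)) x≢y ⟩
      1                                    ≡⟨ ⟦⟧-complement (x ≟ w) ⟨
      ⟦ ¬? (x ≟ w) ⟧ ℕ.+ ⟦ x ≟ w ⟧         ≡⟨ ≡.cong (ℕ._+ ⟦ x ≟ w ⟧) (cut-or-both w y) ⟨
      cuts w y ℕ.+ both w y ℕ.+ ⟦ x ≟ w ⟧  ≡⟨ ≡.cong (λ b → cuts w y ℕ.+ b ℕ.+ ⟦ x ≟ w ⟧) both-sym ⟩
      cuts w y ℕ.+ both y w ℕ.+ ⟦ x ≟ w ⟧  ≡⟨ solve 3 (λ a b c → a :+ b :+ c := a :+ c :+ b) ≡.refl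
                                                (cuts w y) (both y w) ⟦ x ≟ w ⟧ ⟩
      cuts w y ℕ.+ ⟦ x ≟ w ⟧ ℕ.+ both y w  ∎)
      where
      open +-*-Solver using (solve; _:=_; _:+_; _:*_)
      cuts both : V G → V G → ℕ
      cuts u v = ∑[ d ← darts x ] ⟦ cut? T (proj₂ d) (proj₁ d) u v ⟧
      both? : ∀ u v d → Dec (proj₂ d ∈ T × T - proj₂ d ⊢ proj₁ d ~ u × T - proj₂ d ⊢ proj₁ d ~ v)
      both? u v (z , i) = (i ∈? T) ×-dec ((T - i ⊢ z ~? u) ×-dec (T - i ⊢ z ~? v))
      both u v = ∑[ d ← darts x ] ⟦ both? u v d ⟧

      both-sym : both w y ≡ both y w
      both-sym = ∑-cong (darts x) λ d → ⟦⟧-cong (both? w y d) (both? y w d)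
        (λ (i∈T , p , q) → i∈T , q , p) (λ (i∈T , p , q) → i∈T , q , p)

      cut-or-both : ∀ u v → cuts u v ℕ.+ both u v ≡ ⟦ ¬? (x ≟ u) ⟧
      cut-or-both u v = begin
        cuts u v ℕ.+ both u v
          ≡⟨ ∑-distrib-+ (darts x) (λ d → ⟦ cut? T (proj₂ d) (proj₁ d) u v ⟧) (λ d → ⟦ both? u v d ⟧) ⟨
        ∑[ d ← darts x ] (⟦ cut? T (proj₂ d) (proj₁ d) u v ⟧ ℕ.+ ⟦ both? u v d ⟧)
          ≡⟨ ∑-cong (darts x) pointwise ⟩
        ∑[ d ← darts x ] ⟦ exit? u d ⟧
          ≡⟨ ∑-exits x u ⟩
        ⟦ ¬? (x ≟ u) ⟧ ∎
        where
        cases : ∀ {A B C : Set} (a? : Dec A) (b? : Dec B) (c? : Dec C) →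
                ⟦ a? ×-dec (b? ×-dec ¬? c?) ⟧ ℕ.+ ⟦ a? ×-dec (b? ×-dec c?) ⟧ ≡ ⟦ a? ×-dec b? ⟧
        cases (no _)  _       _       = ≡.refl
        cases (yes _) (no _)  _       = ≡.refl
        cases (yes _) (yes _) (no _)  = ≡.refl
        cases (yes _) (yes _) (yes _) = ≡.refl

        pointwise : ∀ d → ⟦ cut? T (proj₂ d) (proj₁ d) u v ⟧ ℕ.+ ⟦ both? u v d ⟧ ≡ ⟦ exit? u d ⟧
        pointwise (z , i) = cases (i ∈? T) (T - i ⊢ z ~? u) (T - i ⊢ z ~? v)

  cutTrees : V G → V G → V G → ℕ
  cutTrees x y w =
    ∑[ T ← forests ] (⟦ tree? T ⟧ ℕ.* ∑[ d ← darts x ] ⟦ cut? T (proj₂ d) (proj₁ d) y w ⟧)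

  ∑-L : ∀ x w y → ∑[ d ← darts x ] L x w (proj₁ d) y ≡ cutTrees x y w
  ∑-L x w y = begin
    ∑[ d ← darts x ] L x w (proj₁ d) y
      ≡⟨ ∑-cong-∈ (darts x) (λ d → L-trees (dart⁻ d) w y) ⟩
    ∑[ d ← darts x ] ∑[ T ← forests ] (⟦ tree? T ⟧ ℕ.* ⟦ cut? T (proj₂ d) (proj₁ d) y w ⟧)
      ≡⟨ ∑-comm (darts x) forests (λ d T → ⟦ tree? T ⟧ ℕ.* ⟦ cut? T (proj₂ d) (proj₁ d) y w ⟧) ⟩
    ∑[ T ← forests ] ∑[ d ← darts x ] (⟦ tree? T ⟧ ℕ.* ⟦ cut? T (proj₂ d) (proj₁ d) y w ⟧)
      ≡⟨ ∑-cong forests (λ T → ≡.sym (*-distribˡ-∑ (darts x) ⟦ tree? T ⟧ (λ d → ⟦ cut? T (proj₂ d) (proj₁ d) y w ⟧))) ⟩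
    cutTrees x y w ∎

  cutTrees-swap : ∀ {x y} w → x ≢ y → cutTrees x y w ≡ cutTrees x w y ℕ.+ ⟦ x ≟ w ⟧ ℕ.* τ G
  cutTrees-swap {x} {y} w x≢y = begin
    cutTrees x y w
      ≡⟨ ∑-cong forests swapped ⟩
    ∑[ T ← forests ] (⟦ tree? T ⟧ ℕ.* cuts T w y ℕ.+ ⟦ x ≟ w ⟧ ℕ.* ⟦ tree? T ⟧)
      ≡⟨ ∑-distrib-+ forests (λ T → ⟦ tree? T ⟧ ℕ.* cuts T w y) (λ T → ⟦ x ≟ w ⟧ ℕ.* ⟦ tree? T ⟧) ⟩
    cutTrees x w y ℕ.+ ∑[ T ← forests ] (⟦ x ≟ w ⟧ ℕ.* ⟦ tree? T ⟧)
      ≡⟨ ≡.cong (cutTrees x w y ℕ.+_) (*-distribˡ-∑ forests ⟦ x ≟ w ⟧ (λ T → ⟦ tree? T ⟧)) ⟨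
    cutTrees x w y ℕ.+ ⟦ x ≟ w ⟧ ℕ.* ∑[ T ← forests ] ⟦ tree? T ⟧
      ≡⟨ ≡.cong (λ t → cutTrees x w y ℕ.+ ⟦ x ≟ w ⟧ ℕ.* t) (length-filter-∑ tree? forests) ⟨
    cutTrees x w y ℕ.+ ⟦ x ≟ w ⟧ ℕ.* τ G ∎
    where
    cuts : Subset (length edges) → V G → V G → ℕ
    cuts T u v = ∑[ d ← darts x ] ⟦ cut? T (proj₂ d) (proj₁ d) u v ⟧
    swapped : ∀ T → ⟦ tree? T ⟧ ℕ.* cuts T y w ≡ ⟦ tree? T ⟧ ℕ.* cuts T w y ℕ.+ ⟦ x ≟ w ⟧ ℕ.* ⟦ tree? T ⟧
    swapped T = by-cases (tree? T)
      where
      by-cases : (d : Dec (Tree T)) → ⟦ d ⟧ ℕ.* cuts T y w ≡ ⟦ d ⟧ ℕ.* cuts T w y ℕ.+ ⟦ x ≟ w ⟧ ℕ.* ⟦ d ⟧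
      by-cases (no _)     = ≡.sym (ℕₚ.*-zeroʳ ⟦ x ≟ w ⟧)
      by-cases (yes tree) = begin
        1 ℕ.* cuts T y w                           ≡⟨ ℕₚ.*-identityˡ _ ⟩
        cuts T y w                                 ≡⟨ ∑-cuts tree w x≢y ⟩
        cuts T w y ℕ.+ ⟦ x ≟ w ⟧                   ≡⟨ ≡.cong₂ ℕ._+_ (ℕₚ.*-identityˡ (cuts T w y))
                                                                   (ℕₚ.*-identityʳ ⟦ x ≟ w ⟧) ⟨
        1 ℕ.* cuts T w y ℕ.+ ⟦ x ≟ w ⟧ ℕ.* 1       ∎

  -- Up to the factor τ, the equation of the Green function of the walk killed at y: off y, the
  -- Laplacian of `K` in its first argument is τ at w and 0 elsewhere. Summed over the darts, the
  -- two `L` terms of `K-exchange` become `cutTrees` with w and y in opposite orders, which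
  -- `cutTrees-swap` compares.
  K-harmonic : ∀ {x y} w → x ≢ y →
               ∑[ d ← darts x ] K x w y ≡ ∑[ d ← darts x ] K (proj₁ d) w y ℕ.+ ⟦ x ≟ w ⟧ ℕ.* τ G
  K-harmonic {x} {y} w x≢y = ℕₚ.+-cancelʳ-≡ (cutTrees x w y) _ _ (begin
    ∑[ d ← darts x ] K x w y ℕ.+ cutTrees x w y
      -- Naming the two components in the other order turns F(zw∣xy) into F(xy∣zw), which is the
      -- form treated by `∑-L`, with w and y exchanged.
      ≡⟨ ≡.cong (∑[ d ← darts x ] K x w y ℕ.+_)
           (≡.trans (∑-cong (darts x) (λ d → L-swap (proj₁ d) w x y)) (∑-L x y w)) ⟨
    ∑[ d ← darts x ] K x w y ℕ.+ ∑[ d ← darts x ] L (proj₁ d) w x y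
      ≡⟨ ∑-distrib-+ (darts x) (λ d → K x w y) (λ d → L (proj₁ d) w x y) ⟨
    ∑[ d ← darts x ] (K x w y ℕ.+ L (proj₁ d) w x y)
      ≡⟨ ∑-cong (darts x) (λ d → K-exchange x (proj₁ d) w y) ⟩
    ∑[ d ← darts x ] (K (proj₁ d) w y ℕ.+ L x w (proj₁ d) y)
      ≡⟨ ∑-distrib-+ (darts x) (λ d → K (proj₁ d) w y) (λ d → L x w (proj₁ d) y) ⟩
    k ℕ.+ ∑[ d ← darts x ] L x w (proj₁ d) y
      ≡⟨ ≡.cong (k ℕ.+_) (≡.trans (∑-L x w y) (cutTrees-swap w x≢y)) ⟩
    k ℕ.+ (cutTrees x w y ℕ.+ ⟦ x ≟ w ⟧ ℕ.* τ G)
      ≡⟨ solve 3 (λ a b c → a :+ (b :+ c) := a :+ c :+ b) ≡.refl k (cutTrees x w y) (⟦ x ≟ w ⟧ ℕ.* τ G) ⟩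
    k ℕ.+ ⟦ x ≟ w ⟧ ℕ.* τ G ℕ.+ cutTrees x w y ∎)
    where
    open +-*-Solver using (solve; _:=_; _:+_; _:*_)
    k = ∑[ d ← darts x ] K (proj₁ d) w y

  -- τ times the expected hitting time of y from x, kept among the natural numbers until the
  -- division by τ.
  hittingWeight : V G → V G → ℕ
  hittingWeight x y = ∑[ w ← vertices ] (degree G w ℕ.* K x w y)

  hittingWeight-target : ∀ y → hittingWeight y y ≡ 0
  hittingWeight-target y = ∑-zero vertices λ w → ≡.trans
    (≡.cong (degree G w ℕ.*_) (∑-zero forests λ S →
      ⟦⟧-no (together? y w y S) (λ (sep , y~w) → separated sep (~-sym y~w))))
    (ℕₚ.*-zeroʳ (degree G w))

  hittingWeight-harmonic : ∀ {x y} → x ≢ y →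
    degree G x ℕ.* hittingWeight x y ≡
    ∑[ z ← vertices ] (⟦ adj? x z ⟧ ℕ.* hittingWeight z y) ℕ.+ degree G x ℕ.* τ G
  hittingWeight-harmonic {x} {y} x≢y = begin
    degree G x ℕ.* hittingWeight x y
      ≡⟨ degree-darts x (hittingWeight x y) ⟩
    ∑[ d ← darts x ] ∑[ w ← vertices ] (degree G w ℕ.* K x w y)
      ≡⟨ ∑-comm (darts x) vertices (λ d w → degree G w ℕ.* K x w y) ⟩
    ∑[ w ← vertices ] ∑[ d ← darts x ] (degree G w ℕ.* K x w y)
      ≡⟨ ∑-cong vertices step-w ⟩
    ∑[ w ← vertices ] (∑[ d ← darts x ] (degree G w ℕ.* K (proj₁ d) w y) ℕ.+ ⟦ x ≟ w ⟧ ℕ.* (degree G w ℕ.* τ G))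
      ≡⟨ ∑-distrib-+ vertices (λ w → ∑[ d ← darts x ] (degree G w ℕ.* K (proj₁ d) w y))
                              (λ w → ⟦ x ≟ w ⟧ ℕ.* (degree G w ℕ.* τ G)) ⟩
    ∑[ w ← vertices ] ∑[ d ← darts x ] (degree G w ℕ.* K (proj₁ d) w y) ℕ.+
    ∑[ w ← vertices ] (⟦ x ≟ w ⟧ ℕ.* (degree G w ℕ.* τ G))
      ≡⟨ ≡.cong₂ ℕ._+_ (∑-comm vertices (darts x) (λ w d → degree G w ℕ.* K (proj₁ d) w y)) source ⟩
    ∑[ d ← darts x ] hittingWeight (proj₁ d) y ℕ.+ degree G x ℕ.* τ G
      ≡⟨ ≡.cong (ℕ._+ degree G x ℕ.* τ G) (∑-darts x (λ z → hittingWeight z y)) ⟨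
    ∑[ z ← vertices ] (⟦ adj? x z ⟧ ℕ.* hittingWeight z y) ℕ.+ degree G x ℕ.* τ G ∎
    where
    open +-*-Solver using (solve; _:=_; _:+_; _:*_)
    step-w : ∀ w → ∑[ d ← darts x ] (degree G w ℕ.* K x w y) ≡
                   ∑[ d ← darts x ] (degree G w ℕ.* K (proj₁ d) w y) ℕ.+ ⟦ x ≟ w ⟧ ℕ.* (degree G w ℕ.* τ G)
    step-w w = begin
      ∑[ d ← darts x ] (degree G w ℕ.* K x w y)
        ≡⟨ *-distribˡ-∑ (darts x) (degree G w) (λ d → K x w y) ⟨
      degree G w ℕ.* ∑[ d ← darts x ] K x w y
        ≡⟨ ≡.cong (degree G w ℕ.*_) (K-harmonic w x≢y) ⟩
      degree G w ℕ.* (k ℕ.+ ⟦ x ≟ w ⟧ ℕ.* τ G)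
        ≡⟨ solve 4 (λ d k s t → d :* (k :+ s :* t) := d :* k :+ s :* (d :* t)) ≡.refl (degree G w) k ⟦ x ≟ w ⟧ (τ G) ⟩
      degree G w ℕ.* k ℕ.+ ⟦ x ≟ w ⟧ ℕ.* (degree G w ℕ.* τ G)
        ≡⟨ ≡.cong (ℕ._+ ⟦ x ≟ w ⟧ ℕ.* (degree G w ℕ.* τ G))
             (*-distribˡ-∑ (darts x) (degree G w) (λ d → K (proj₁ d) w y)) ⟩
      ∑[ d ← darts x ] (degree G w ℕ.* K (proj₁ d) w y) ℕ.+ ⟦ x ≟ w ⟧ ℕ.* (degree G w ℕ.* τ G) ∎
      where k = ∑[ d ← darts x ] K (proj₁ d) w y
    source : ∑[ w ← vertices ] (⟦ x ≟ w ⟧ ℕ.* (degree G w ℕ.* τ G)) ≡ degree G x ℕ.* τ G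
    source = ≡.trans
      (∑-single vertices-unique (∈-vertices x) (λ {w} _ w≢x →
        ≡.cong (ℕ._* (degree G w ℕ.* τ G)) (⟦⟧-no (x ≟ w) (w≢x ∘ ≡.sym))))
      (≡.trans (≡.cong (ℕ._* (degree G x ℕ.* τ G)) (⟦⟧-yes (x ≟ x) ≡.refl)) (ℕₚ.*-identityˡ _))

  -- In a separating forest every w lies in exactly one of the two trees.
  K-commute : ∀ x y w → K x w y ℕ.+ K y w x ≡ F G x y
  K-commute x y w = begin
    K x w y ℕ.+ K y w x
      ≡⟨ ∑-distrib-+ forests (λ S → ⟦ together? x w y S ⟧) (λ S → ⟦ together? y w x S ⟧) ⟨
    ∑[ S ← forests ] (⟦ together? x w y S ⟧ ℕ.+ ⟦ together? y w x S ⟧)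
      ≡⟨ ∑-cong forests pointwise ⟩
    ∑[ S ← forests ] ⟦ separating? G x y S ⟧
      ≡⟨ length-filter-∑ (separating? G x y) forests ⟨
    F G x y ∎
    where
    collect : ∀ {x y S} → Together x w y S → Separating G x y S
    collect {x} {y} {S} (sep , x~w) = separating-move {w} {y} {x} {S} x~w sep

    module _ (S : Subset (length edges)) where

      together = ⟦ together? x w y S ⟧ ℕ.+ ⟦ together? y w x S ⟧

      neither : ¬ Separating G x y S → together ≡ 0
      neither ¬sep = ≡.cong₂ ℕ._+_
        (⟦⟧-no (together? x w y S) (λ t → ¬sep (collect {x} {y} {S} t)))
        (⟦⟧-no (together? y w x S) (λ t → ¬sep (separating-sym {y} {x} {S} (collect {y} {x} {S} t))))

      exactly-one : Separating G x y S → S ⊢ w ~ x ⊎ S ⊢ w ~ y → together ≡ 1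
      exactly-one sep (inj₁ w~x) = ≡.cong₂ ℕ._+_
        (⟦⟧-yes (together? x w y S) (separating-move {x} {y} {w} {S} w~x sep , ~-sym w~x))
        (⟦⟧-no (together? y w x S) (λ (sep′ , _) → separated {w} {x} {S} sep′ w~x))
      exactly-one sep (inj₂ w~y) = ≡.cong₂ ℕ._+_
        (⟦⟧-no (together? x w y S) (λ (sep′ , _) → separated {w} {y} {S} sep′ w~y))
        (⟦⟧-yes (together? y w x S)
          (separating-move {y} {x} {w} {S} w~y (separating-sym {x} {y} {S} sep) , ~-sym w~y))

      by-cases : (d : Dec (Separating G x y S)) → together ≡ ⟦ d ⟧
      by-cases (no ¬sep) = neither ¬sep
      by-cases (yes sep) = exactly-one sep (separating-cover {x} {y} {S} sep w)

    pointwise : ∀ S → ⟦ together? x w y S ⟧ ℕ.+ ⟦ together? y w x S ⟧ ≡ ⟦ separating? G x y S ⟧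
    pointwise S = by-cases S (separating? G x y S)

  hittingWeight-commute : ∀ x y →
    hittingWeight x y ℕ.+ hittingWeight y x ≡ ∑[ w ← vertices ] degree G w ℕ.* F G x y
  hittingWeight-commute x y = begin
    hittingWeight x y ℕ.+ hittingWeight y x
      ≡⟨ ∑-distrib-+ vertices (λ w → degree G w ℕ.* K x w y) (λ w → degree G w ℕ.* K y w x) ⟨
    ∑[ w ← vertices ] (degree G w ℕ.* K x w y ℕ.+ degree G w ℕ.* K y w x)
      ≡⟨ ∑-cong vertices (λ w → ≡.trans (≡.sym (ℕₚ.*-distribˡ-+ (degree G w) (K x w y) (K y w x)))
                                        (≡.cong (degree G w ℕ.*_) (K-commute x y w))) ⟩
    ∑[ w ← vertices ] (degree G w ℕ.* F G x y)
      ≡⟨ *-distribʳ-∑ vertices (F G x y) (degree G) ⟨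
    ∑[ w ← vertices ] degree G w ℕ.* F G x y ∎

  -- Deleting an edge that is not a bridge keeps the subgraph connected.
  spanningTree : ∀ S → Connected (spanning G S) → Acc ℕ._<_ ∣ S ∣ → ∃ Tree
  spanningTree S connected (acc smaller)
    with Finₚ.any? (λ i → (i ∈? S) ×-dec (S - i ⊢ proj₁ (lookup edges i) ~? proj₂ (lookup edges i)))
  ... | yes (i , i∈S , detour) =
    spanningTree (S - i) reconnected (smaller (Subsetₚ.x∈p⇒∣p-x∣<∣p∣ i∈S))
    where
    reconnected : Connected (spanning G (S - i))
    reconnected u v with ~-split (inj₁ ≡.refl) (connected u v)
    ... | inj₁ u~v              = u~v
    ... | inj₂ (inj₁ (u~a , b~v)) = u~a ◅◅ detour ◅◅ b~v
    ... | inj₂ (inj₂ (u~b , a~v)) = u~b ◅◅ ~-sym detour ◅◅ a~v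
  ... | no ¬detour = S , connected , bridges⇒acyclic bridges
    where
    bridges : Bridges S
    bridges {i} i∈S (inj₁ eq) x~y =
      ¬detour (i , i∈S , ≡.subst (λ (a , b) → S - i ⊢ a ~ b) (≡.sym eq) x~y)
    bridges {i} i∈S (inj₂ eq) x~y =
      ¬detour (i , i∈S , ≡.subst (λ (a , b) → S - i ⊢ a ~ b) (≡.sym eq) (~-sym x~y))

  τ>0 : Connected G → 0 ℕ.< τ G
  τ>0 connected = ≡.subst (0 ℕ.<_) (≡.sym (length-filter-∑ tree? forests))
    (ℕₚ.≤-trans (ℕₚ.≤-reflexive (≡.sym (⟦⟧-yes (tree? (proj₁ T)) (proj₂ T))))
                (term≤∑ (λ S → ⟦ tree? S ⟧) (∈-subsets (proj₁ T))))
    where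
    full : Connected (spanning G ⊤)
    full u v = Star.map (λ x~y → let i , i-xy = adj⇒joins x~y in i , Subsetₚ.∈⊤ , i-xy) (connected u v)
    T : ∃ Tree
    T = spanningTree ⊤ full (<-wellFounded _)

-- Natural numbers as rationals

ι : ℕ → ℚ
ι n = + n / 1

toℚᵘ-/ : ∀ i d-1 → ℚ.toℚᵘ (i / suc d-1) ℚᵘ.≃ mkℚᵘ i d-1
toℚᵘ-/ i d-1 = ℚₚ.toℚᵘ-fromℚᵘ (mkℚᵘ i d-1)

ι-+ : ∀ m n → ι (m ℕ.+ n) ≡ ι m ℚ.+ ι n
ι-+ m n = ℚₚ.toℚᵘ-injective (begin
  ℚ.toℚᵘ (ι (m ℕ.+ n))            ≈⟨ toℚᵘ-/ (+ (m ℕ.+ n)) 0 ⟩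
  mkℚᵘ (+ (m ℕ.+ n)) 0            ≈⟨ ℚᵘ.*≡* (≡.cong (ℤ._* + 1)
                                       (≡.cong₂ ℤ._+_ (≡.sym (ℤₚ.*-identityʳ (+ m))) (≡.sym (ℤₚ.*-identityʳ (+ n))))) ⟩
  mkℚᵘ (+ m) 0 ℚᵘ.+ mkℚᵘ (+ n) 0  ≈⟨ ℚᵘₚ.+-cong (toℚᵘ-/ (+ m) 0) (toℚᵘ-/ (+ n) 0) ⟨
  ℚ.toℚᵘ (ι m) ℚᵘ.+ ℚ.toℚᵘ (ι n)  ≈⟨ ℚₚ.toℚᵘ-homo-+ (ι m) (ι n) ⟨
  ℚ.toℚᵘ (ι m ℚ.+ ι n)            ∎)
  where open ℚᵘₚ.≃-Reasoning

ι-* : ∀ m n → ι (m ℕ.* n) ≡ ι m ℚ.* ι n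
ι-* m n = ℚₚ.toℚᵘ-injective (begin
  ℚ.toℚᵘ (ι (m ℕ.* n))            ≈⟨ toℚᵘ-/ (+ (m ℕ.* n)) 0 ⟩
  mkℚᵘ (+ (m ℕ.* n)) 0            ≈⟨ ℚᵘ.*≡* (≡.cong (ℤ._* + 1) (ℤₚ.pos-* m n)) ⟩
  mkℚᵘ (+ m) 0 ℚᵘ.* mkℚᵘ (+ n) 0  ≈⟨ ℚᵘₚ.*-cong (toℚᵘ-/ (+ m) 0) (toℚᵘ-/ (+ n) 0) ⟨
  ℚ.toℚᵘ (ι m) ℚᵘ.* ℚ.toℚᵘ (ι n)  ≈⟨ ℚₚ.toℚᵘ-homo-* (ι m) (ι n) ⟨
  ℚ.toℚᵘ (ι m ℚ.* ι n)            ∎)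
  where open ℚᵘₚ.≃-Reasoning

ι-/ : ∀ n d .{{_ : NonZero d}} → ι d ℚ.* (+ n / d) ≡ ι n
ι-/ n d@(suc d-1) = ℚₚ.toℚᵘ-injective (begin
  ℚ.toℚᵘ (ι d ℚ.* (+ n / d))            ≈⟨ ℚₚ.toℚᵘ-homo-* (ι d) (+ n / d) ⟩
  ℚ.toℚᵘ (ι d) ℚᵘ.* ℚ.toℚᵘ (+ n / d)    ≈⟨ ℚᵘₚ.*-cong (toℚᵘ-/ (+ d) 0) (toℚᵘ-/ (+ n) d-1) ⟩
  mkℚᵘ (+ d) 0 ℚᵘ.* mkℚᵘ (+ n) d-1      ≈⟨ ℚᵘ.*≡* (≡.trans (ℤₚ.*-identityʳ (+ d ℤ.* + n))
                                             (≡.trans (ℤₚ.*-comm (+ d) (+ n))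
                                             (≡.cong (λ e → + n ℤ.* + e) (≡.sym (ℕₚ.*-identityˡ d))))) ⟩
  mkℚᵘ (+ n) 0                          ≈⟨ toℚᵘ-/ (+ n) 0 ⟨
  ℚ.toℚᵘ (ι n)                          ∎)
  where open ℚᵘₚ.≃-Reasoning

0≤ι : ∀ n → 0ℚ ℚ.≤ ι n
0≤ι n = ℚₚ.nonNegative⁻¹ (ι n) {{ℚₚ.normalize-nonNeg n 1}}

-- Order estimates and explicit rates of convergence

≤-+ʳ : ∀ p {q} → 0ℚ ℚ.≤ q → p ℚ.≤ p ℚ.+ q
≤-+ʳ p 0≤q = ≡.subst (ℚ._≤ p ℚ.+ _) (ℚₚ.+-identityʳ p) (ℚₚ.+-monoʳ-≤ p 0≤q)

0≤+ : ∀ {p q} → 0ℚ ℚ.≤ p → 0ℚ ℚ.≤ q → 0ℚ ℚ.≤ p ℚ.+ q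
0≤+ {p} 0≤p 0≤q = ℚₚ.≤-trans 0≤p (≤-+ʳ p 0≤q)

*-monoˡ : ∀ {p q r} → 0ℚ ℚ.≤ r → p ℚ.≤ q → r ℚ.* p ℚ.≤ r ℚ.* q
*-monoˡ {r = r} 0≤r = ℚₚ.*-monoˡ-≤-nonNeg r {{ℚ.nonNegative 0≤r}}

*-monoʳ : ∀ {p q r} → 0ℚ ℚ.≤ r → p ℚ.≤ q → p ℚ.* r ℚ.≤ q ℚ.* r
*-monoʳ {r = r} 0≤r = ℚₚ.*-monoʳ-≤-nonNeg r {{ℚ.nonNegative 0≤r}}

0≤* : ∀ {p q} → 0ℚ ℚ.≤ p → 0ℚ ℚ.≤ q → 0ℚ ℚ.≤ p ℚ.* q
0≤* {p} {q} 0≤p 0≤q = ≡.subst (ℚ._≤ p ℚ.* q) (ℚₚ.*-zeroʳ p) (*-monoˡ 0≤p 0≤q)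

0≤q-p : ∀ {p q} → p ℚ.≤ q → 0ℚ ℚ.≤ q ℚ.- p
0≤q-p {p} {q} p≤q = ≡.subst (ℚ._≤ q ℚ.- p) (ℚₚ.+-inverseʳ p) (ℚₚ.+-monoˡ-≤ (ℚ.- p) p≤q)

ι-mono : ∀ {m n} → m ℕ.≤ n → ι m ℚ.≤ ι n
ι-mono {m} {n} m≤n = ≡.subst (ι m ℚ.≤_) (≡.trans (≡.sym (ι-+ m (n ℕ.∸ m))) (≡.cong ι (ℕₚ.m+[n∸m]≡n m≤n)))
                             (≤-+ʳ (ι m) (0≤ι (n ℕ.∸ m)))

ι-suc : ∀ n → ι (suc n) ≡ 1ℚ ℚ.+ ι n
ι-suc = ι-+ 1

ι<ι-suc : ∀ n → ι n ℚ.< ι (suc n)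
ι<ι-suc n = ≡.subst₂ ℚ._<_ (ℚₚ.+-identityˡ (ι n)) (≡.sym (ι-suc n))
  (ℚₚ.+-monoˡ-< (ι n) (ℚₚ.positive⁻¹ 1ℚ))

-- Clearing the denominator of a positive δ leaves a positive integer.
1≤denominator*δ : ∀ δ → 0ℚ ℚ.< δ → 1ℚ ℚ.≤ ι (ℚ.↧ₙ δ) ℚ.* δ
1≤denominator*δ δ@(mkℚ (+ n) d-1 _) 0<δ = ≡.subst (1ℚ ℚ.≤_) cleared (ι-mono (positive n (ℚ.positive 0<δ)))
  where
  positive : ∀ n → ℤ.Positive (+ n) → 1 ℕ.≤ n
  positive (suc n) _ = ℕ.s≤s ℕ.z≤n
  cleared : ι n ≡ ι (suc d-1) ℚ.* δ
  cleared = ≡.trans (≡.sym (ι-/ n (suc d-1))) (≡.cong (ι (suc d-1) ℚ.*_) (ℚₚ.↥p/↧p≡p δ))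
1≤denominator*δ (mkℚ -[1+ n ] d-1 c) 0<δ with () ← ℚ.positive {mkℚ -[1+ n ] d-1 c} 0<δ

archimedean : ∀ D δ → 0ℚ ℚ.< δ → ∃ λ M → ι D ℚ.< ι M ℚ.* δ
-- The denominator of δ lifts the product to at least 1, and one factor more than D makes the
-- inequality strict.
archimedean D δ 0<δ = suc D ℕ.* ℚ.↧ₙ δ , (begin-strict
  ι D                               <⟨ ι<ι-suc D ⟩
  ι (suc D)                         ≡⟨ ℚₚ.*-identityʳ (ι (suc D)) ⟨
  ι (suc D) ℚ.* 1ℚ                  ≤⟨ *-monoˡ (0≤ι (suc D)) (1≤denominator*δ δ 0<δ) ⟩
  ι (suc D) ℚ.* (ι (ℚ.↧ₙ δ) ℚ.* δ)  ≡⟨ ℚₚ.*-assoc (ι (suc D)) (ι (ℚ.↧ₙ δ)) δ ⟨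
  ι (suc D) ℚ.* ι (ℚ.↧ₙ δ) ℚ.* δ    ≡⟨ ≡.cong (ℚ._* δ) (ι-* (suc D) (ℚ.↧ₙ δ)) ⟨
  ι (suc D ℕ.* ℚ.↧ₙ δ) ℚ.* δ        ∎)
  where open ℚₚ.≤-Reasoning

-- The rate D/(n+1) supplies the threshold through `archimedean`. The index of s is shifted because
-- `upTo (suc n)` is the first range that includes time n, to which the error `e n` belongs; the
-- threshold `suc M` keeps `s 0` out.
converges-from-below : ∀ {s : ℕ → ℚ} {l} (e : ℕ → ℚ) D → (∀ n → s (suc n) ℚ.+ e n ≡ l) →
                       (∀ n → 0ℚ ℚ.≤ e n) → (∀ n → ι (suc n) ℚ.* e n ℚ.≤ ι D) → ConvergesTo s l
converges-from-below {s} {l} e D s+e≡l 0≤e e≤D δ 0<δ with M , D<Mδ ← archimedean D δ 0<δ =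
  suc M , λ { (suc n) (ℕ.s≤s M≤n) → ≡.subst (ℚ._< δ) (≡.sym (distance n)) (small n M≤n) }
  where
  open ℚₚ.≤-Reasoning
  distance : ∀ n → ℚ.∣ s (suc n) ℚ.- l ∣ ≡ e n
  distance n = ≡.trans (≡.cong (λ l → ℚ.∣ s (suc n) ℚ.- l ∣) (≡.sym (s+e≡l n)))
    (≡.trans (≡.cong ℚ.∣_∣ (solve 2 (λ s e → s :- (s :+ e) := :- e) ≡.refl (s (suc n)) (e n)))
    (≡.trans (ℚₚ.∣-p∣≡∣p∣ (e n)) (ℚₚ.0≤p⇒∣p∣≡p (0≤e n))))
    where open ℚ-Solver using (solve; _:=_; _:+_; _:-_; :-_)
  small : ∀ n → M ℕ.≤ n → e n ℚ.< δ
  small n M≤n = ℚₚ.*-cancelˡ-<-nonNeg (ι (suc n)) {{ℚ.nonNegative (0≤ι (suc n))}} (begin-strict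
    ι (suc n) ℚ.* e n  ≤⟨ e≤D n ⟩
    ι D                <⟨ D<Mδ ⟩
    ι M ℚ.* δ          ≤⟨ *-monoʳ (ℚₚ.<⇒≤ 0<δ) (ι-mono (ℕₚ.≤-trans M≤n (ℕₚ.n≤1+n n))) ⟩
    ι (suc n) ℚ.* δ    ∎)

-- If a decreases by at least a fixed fraction of itself, then (n+2C)(n+2C+1)·aₙ is decreasing;
-- this gives a quadratic rate of decay without exponentials.
module Decay (a : ℕ → ℚ) (C : ℕ) (1≤C : 1 ℕ.≤ C) (0≤a : ∀ n → 0ℚ ℚ.≤ a n)
             (0≤drop : ∀ n → 0ℚ ℚ.≤ a n ℚ.- a (suc n))
             (a≤C*drop : ∀ n → a n ℚ.≤ ι C ℚ.* (a n ℚ.- a (suc n)))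
             (a₀≤C : a 0 ℚ.≤ ι C) where
  open ℚₚ.≤-Reasoning

  scale : ℕ → ℕ
  scale n = (n ℕ.+ 2 ℕ.* C) ℕ.* suc (n ℕ.+ 2 ℕ.* C)

  -- With s = n + 2C and the common factor s + 1 removed, the claim is 2·a(n+1) ≤ s·drop. The slack
  -- is n·drop + 2(C·drop - a n) + 2·drop, a sum of nonnegative terms; the shift by 2C is what makes
  -- the middle term available.
  scaled-step : ∀ n → ι (scale (suc n)) ℚ.* a (suc n) ℚ.≤ ι (scale n) ℚ.* a n
  scaled-step n = begin
    ι (scale (suc n)) ℚ.* a (suc n)
      ≤⟨ ≤-+ʳ _ (0≤* (0≤ι (suc s)) (0≤+ (0≤+ (0≤* (0≤ι n) (0≤drop n)) (0≤* (0≤ι 2) (0≤q-p (a≤C*drop n))))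
                                      (0≤* (0≤ι 2) (0≤drop n)))) ⟩
    ι (scale (suc n)) ℚ.* a (suc n) ℚ.+
      ι (suc s) ℚ.* (ι n ℚ.* drop ℚ.+ ι 2 ℚ.* (ι C ℚ.* drop ℚ.- a n) ℚ.+ ι 2 ℚ.* drop)
      ≡⟨ ≡.cong₂ (λ p q → p ℚ.* a (suc n) ℚ.+ q ℚ.* (ι n ℚ.* drop ℚ.+ ι 2 ℚ.* (ι C ℚ.* drop ℚ.- a n) ℚ.+ ι 2 ℚ.* drop))
                 (≡.trans (ι-* (suc s) (suc (suc s))) 
                   (≡.cong₂ ℚ._*_ ι-ss (≡.trans (ι-suc (suc s)) (≡.cong (1ℚ ℚ.+_) ι-ss)))) ι-ss ⟩
    _ ≡⟨ solve 4 (λ n c p q →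
          (con 1ℚ :+ (n :+ con (ι 2) :* c)) :* (con 1ℚ :+ (con 1ℚ :+ (n :+ con (ι 2) :* c))) :* q :+
          (con 1ℚ :+ (n :+ con (ι 2) :* c)) :*
            (n :* (p :- q) :+ con (ι 2) :* (c :* (p :- q) :- p) :+ con (ι 2) :* (p :- q)) :=
          (n :+ con (ι 2) :* c) :* (con 1ℚ :+ (n :+ con (ι 2) :* c)) :* p)
          ≡.refl (ι n) (ι C) (a n) (a (suc n)) ⟩
    _ ≡⟨ ≡.cong (ℚ._* a n) (≡.trans (ι-* s (suc s)) (≡.cong₂ ℚ._*_ ι-s ι-ss)) ⟨
    ι (scale n) ℚ.* a n ∎
    where
    open ℚ-Solver using (solve; _:=_; _:+_; _:-_; _:*_; con)
    s = n ℕ.+ 2 ℕ.* C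
    drop = a n ℚ.- a (suc n)
    ι-s : ι s ≡ ι n ℚ.+ ι 2 ℚ.* ι C
    ι-s = ≡.trans (ι-+ n (2 ℕ.* C)) (≡.cong (ι n ℚ.+_) (ι-* 2 C))
    ι-ss : ι (suc s) ≡ 1ℚ ℚ.+ (ι n ℚ.+ ι 2 ℚ.* ι C)
    ι-ss = ≡.trans (ι-suc s) (≡.cong (1ℚ ℚ.+_) ι-s)

  bound : ℕ
  bound = scale 0 ℕ.* C

  scaled-bound : ∀ n → ι (scale n) ℚ.* a n ℚ.≤ ι bound
  scaled-bound zero    = ≡.subst (ι (scale 0) ℚ.* a 0 ℚ.≤_) (≡.sym (ι-* (scale 0) C)) (*-monoˡ (0≤ι (scale 0)) a₀≤C)
  scaled-bound (suc n) = ℚₚ.≤-trans (scaled-step n) (scaled-bound n)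

  -- One factor n + 1 pays for the growth of the tail of the mean, the other is the rate demanded by
  -- `converges-from-below`. Since 1 ≤ C, `scale n` is at least (n+1)².
  quadratic-decay : ∀ n → ι (suc n) ℚ.* (ι (suc n) ℚ.* a n) ℚ.≤ ι bound
  quadratic-decay n = begin
    ι (suc n) ℚ.* (ι (suc n) ℚ.* a n)  ≡⟨ ℚₚ.*-assoc (ι (suc n)) (ι (suc n)) (a n) ⟨
    ι (suc n) ℚ.* ι (suc n) ℚ.* a n    ≡⟨ ≡.cong (ℚ._* a n) (ι-* (suc n) (suc n)) ⟨
    ι (suc n ℕ.* suc n) ℚ.* a n        ≤⟨ *-monoʳ (0≤a n) (ι-mono (ℕₚ.*-mono-≤ n<s (ℕₚ.m≤n⇒m≤1+n n<s))) ⟩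
    ι (scale n) ℚ.* a n                ≤⟨ scaled-bound n ⟩
    ι bound                            ∎
    where
    n<s : suc n ℕ.≤ n ℕ.+ 2 ℕ.* C
    n<s = ≡.subst (ℕ._≤ n ℕ.+ 2 ℕ.* C) (ℕₚ.+-comm n 1)
      (ℕₚ.+-monoʳ-≤ n (ℕₚ.≤-trans 1≤C (ℕₚ.m≤n*m C 2)))

-- First passage of the walk killed at a target

module HittingTime (G : Graph) (y : V G) where
  open Graph G hiding (V; order; degree; Reachable)
  open RandomWalk G hiding (IsHittingTime)
  open Summation (CommutativeRing.commutativeSemiring ℚₚ.+-*-commutativeRing)

  -- The operator Q. The indicator tests the vertex that is left, so the t-th iterate on f is the
  -- expectation of f(Z_t) on T_y ≥ t. For the indicator of y this is the probability of T_y = t;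
  -- for f vanishing at y the event may be replaced by T_y > t.
  killed : (V G → ℚ) → V G → ℚ
  killed f u = ⟦ ¬? (u ≟ y) ⟧ ℚ.* ∑[ w ← vertices ] (step u w ℚ.* f w)

  hit : ℕ → V G → ℚ
  hit t u = hitProbability u y t

  first-step : ∀ {t} u w (ws : Vec (V G) t) →
               ⟦ firstHit? y (u ∷ w ∷ ws) ⟧ ≡ ⟦ ¬? (u ≟ y) ⟧ ℚ.* ⟦ firstHit? y (w ∷ ws) ⟧
  first-step u w ws = ≡.trans
    (⟦⟧-cong (firstHit? y (u ∷ w ∷ ws)) (¬? (u ≟ y) ×-dec firstHit? y (w ∷ ws))
      (λ (ends , misses) → misses Fin.zero , ends , misses ∘ Fin.suc)
      (λ (u≢y , ends , misses) → ends , λ { Fin.zero → u≢y ; (Fin.suc s) → misses s }))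
    (⟦⟧-× (¬? (u ≟ y)) (firstHit? y (w ∷ ws)) (¬? (u ≟ y) ×-dec firstHit? y (w ∷ ws)))

  hit-∑ : ∀ t u → hit t u ≡ ∑[ ws ← trajectories t ] (⟦ firstHit? y (u ∷ ws) ⟧ ℚ.* probability u ws)
  hit-∑ t u = ∑-filter (λ ws → firstHit? y (u ∷ ws)) (trajectories t) (probability u)

  hit-zero : ∀ u → hit 0 u ≡ ⟦ u ≟ y ⟧
  hit-zero u = begin
    hit 0 u                                         ≡⟨ hit-∑ 0 u ⟩
    ⟦ firstHit? y (u ∷ []) ⟧ ℚ.* 1ℚ ℚ.+ 0ℚ          ≡⟨ ℚₚ.+-identityʳ _ ⟩
    ⟦ firstHit? y (u ∷ []) ⟧ ℚ.* 1ℚ                 ≡⟨ ℚₚ.*-identityʳ _ ⟩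
    ⟦ firstHit? y (u ∷ []) ⟧                        ≡⟨ ⟦⟧-cong (firstHit? y (u ∷ [])) (u ≟ y)
                                                         proj₁ (λ u≡y → u≡y , λ ()) ⟩
    ⟦ u ≟ y ⟧                                       ∎
    where open ≡.≡-Reasoning

  -- Conditioning on the first step: the probability of a trajectory and, by `first-step`, the event
  -- of a first hit both factor there.
  hit-suc : ∀ t u → hit (suc t) u ≡ killed (hit t) u
  hit-suc t u = begin
    hit (suc t) u
      ≡⟨ hit-∑ (suc t) u ⟩
    ∑[ ws ← trajectories (suc t) ] φ ws
      ≡⟨ ∑-concatMap (λ w → map (w ∷_) (trajectories t)) vertices φ ⟩
    ∑[ w ← vertices ] ∑ (map (w ∷_) (trajectories t)) φ
      ≡⟨ ∑-cong vertices (λ w → ∑-map (w ∷_) (trajectories t) φ) ⟩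
    ∑[ w ← vertices ] ∑[ ws ← trajectories t ] φ (w ∷ ws)
      ≡⟨ ∑-cong vertices after ⟩
    ∑[ w ← vertices ] (⟦ ¬? (u ≟ y) ⟧ ℚ.* (step u w ℚ.* hit t w))
      ≡⟨ *-distribˡ-∑ vertices ⟦ ¬? (u ≟ y) ⟧ (λ w → step u w ℚ.* hit t w) ⟨
    killed (hit t) u ∎
    where
    open ≡.≡-Reasoning
    open ℚ-Solver using (solve; _:=_; _:*_)
    φ : Vec (V G) (suc t) → ℚ
    φ ws = ⟦ firstHit? y (u ∷ ws) ⟧ ℚ.* probability u ws
    after : ∀ w → ∑[ ws ← trajectories t ] φ (w ∷ ws) ≡ ⟦ ¬? (u ≟ y) ⟧ ℚ.* (step u w ℚ.* hit t w)
    after w = begin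
      ∑[ ws ← trajectories t ] φ (w ∷ ws)
        ≡⟨ ∑-cong (trajectories t) (λ ws → ≡.trans (≡.cong (ℚ._* (step u w ℚ.* probability w ws)) (first-step u w ws))
             (solve 4 (λ a b c d → (a :* b) :* (c :* d) := (a :* c) :* (b :* d)) ≡.refl
               ⟦ ¬? (u ≟ y) ⟧ ⟦ firstHit? y (w ∷ ws) ⟧ (step u w) (probability w ws))) ⟩
      ∑[ ws ← trajectories t ] (⟦ ¬? (u ≟ y) ⟧ ℚ.* step u w ℚ.* (⟦ firstHit? y (w ∷ ws) ⟧ ℚ.* probability w ws))
        ≡⟨ *-distribˡ-∑ (trajectories t) (⟦ ¬? (u ≟ y) ⟧ ℚ.* step u w)
             (λ ws → ⟦ firstHit? y (w ∷ ws) ⟧ ℚ.* probability w ws) ⟨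
      ⟦ ¬? (u ≟ y) ⟧ ℚ.* step u w ℚ.* ∑[ ws ← trajectories t ] (⟦ firstHit? y (w ∷ ws) ⟧ ℚ.* probability w ws)
        ≡⟨ ≡.cong (⟦ ¬? (u ≟ y) ⟧ ℚ.* step u w ℚ.*_) (hit-∑ t w) ⟨
      ⟦ ¬? (u ≟ y) ⟧ ℚ.* step u w ℚ.* hit t w
        ≡⟨ ℚₚ.*-assoc ⟦ ¬? (u ≟ y) ⟧ (step u w) (hit t w) ⟩
      ⟦ ¬? (u ≟ y) ⟧ ℚ.* (step u w ℚ.* hit t w) ∎

  0≤⟦⟧ : ∀ {P : Set} (P? : Dec P) → 0ℚ ℚ.≤ ⟦ P? ⟧
  0≤⟦⟧ (yes _) = ℚₚ.nonNegative⁻¹ 1ℚ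
  0≤⟦⟧ (no _)  = ℚₚ.≤-refl

  ∑-mono : ∀ {A : Set} (xs : List A) {f g} → (∀ x → f x ℚ.≤ g x) → ∑ xs f ℚ.≤ ∑ xs g
  ∑-mono []       f≤g = ℚₚ.≤-refl
  ∑-mono (x ∷ xs) f≤g = ℚₚ.+-mono-≤ (f≤g x) (∑-mono xs f≤g)

  step-∑ : ∀ u (f : V G → ℚ) → ∑[ w ← vertices ] (step u w ℚ.* f w) ≡
           reciprocal (degree G u) ℚ.* ∑[ w ← vertices ] (⟦ adj? u w ⟧ ℚ.* f w)
  step-∑ u f = ≡.trans (∑-cong vertices (λ w → weight (adj? u w) (f w)))
    (≡.sym (*-distribˡ-∑ vertices (reciprocal (degree G u)) (λ w → ⟦ adj? u w ⟧ ℚ.* f w)))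
    where
    weight : ∀ {P : Set} (P? : Dec P) c → (if does P? then reciprocal (degree G u) else 0ℚ) ℚ.* c ≡
             reciprocal (degree G u) ℚ.* (⟦ P? ⟧ ℚ.* c)
    weight (yes _) c = ≡.cong (reciprocal (degree G u) ℚ.*_) (≡.sym (ℚₚ.*-identityˡ c))
    weight (no _)  c = ≡.trans (ℚₚ.*-zeroˡ c)
      (≡.sym (≡.trans (≡.cong (reciprocal (degree G u) ℚ.*_) (ℚₚ.*-zeroˡ c)) (ℚₚ.*-zeroʳ (reciprocal (degree G u)))))

  0≤reciprocal : ∀ d → 0ℚ ℚ.≤ reciprocal d
  0≤reciprocal zero    = ℚₚ.≤-refl
  0≤reciprocal (suc d) = ℚₚ.nonNegative⁻¹ (+ 1 / suc d) {{ℚₚ.normalize-nonNeg 1 (suc d)}}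

  0≤step : ∀ u w → 0ℚ ℚ.≤ step u w
  0≤step u w = weight (adj? u w)
    where
    weight : ∀ {P : Set} (P? : Dec P) → 0ℚ ℚ.≤ (if does P? then reciprocal (degree G u) else 0ℚ)
    weight (yes _) = 0≤reciprocal (degree G u)
    weight (no _)  = ℚₚ.≤-refl

  killed-cong : ∀ {f g} → (∀ u → f u ≡ g u) → ∀ u → killed f u ≡ killed g u
  killed-cong f≡g u = ≡.cong (⟦ ¬? (u ≟ y) ⟧ ℚ.*_) (∑-cong vertices (λ w → ≡.cong (step u w ℚ.*_) (f≡g w)))

  killed-+ : ∀ f g u → killed (λ w → f w ℚ.+ g w) u ≡ killed f u ℚ.+ killed g u
  killed-+ f g u = begin
    ⟦ ¬? (u ≟ y) ⟧ ℚ.* ∑[ w ← vertices ] (step u w ℚ.* (f w ℚ.+ g w))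
      ≡⟨ ≡.cong (⟦ ¬? (u ≟ y) ⟧ ℚ.*_) (≡.trans
           (∑-cong vertices (λ w → ℚₚ.*-distribˡ-+ (step u w) (f w) (g w)))
           (∑-distrib-+ vertices (λ w → step u w ℚ.* f w) (λ w → step u w ℚ.* g w))) ⟩
    ⟦ ¬? (u ≟ y) ⟧ ℚ.* (∑[ w ← vertices ] (step u w ℚ.* f w) ℚ.+ ∑[ w ← vertices ] (step u w ℚ.* g w))
      ≡⟨ ℚₚ.*-distribˡ-+ ⟦ ¬? (u ≟ y) ⟧ (∑[ w ← vertices ] (step u w ℚ.* f w)) _ ⟩
    killed f u ℚ.+ killed g u ∎
    where open ≡.≡-Reasoning

  killed-scale : ∀ c f u → killed (λ w → c ℚ.* f w) u ≡ c ℚ.* killed f u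
  killed-scale c f u = begin
    ⟦ ¬? (u ≟ y) ⟧ ℚ.* ∑[ w ← vertices ] (step u w ℚ.* (c ℚ.* f w))
      ≡⟨ ≡.cong (⟦ ¬? (u ≟ y) ⟧ ℚ.*_) (≡.trans
           (∑-cong vertices (λ w → exchange (step u w) c (f w)))
           (≡.sym (*-distribˡ-∑ vertices c (λ w → step u w ℚ.* f w)))) ⟩
    ⟦ ¬? (u ≟ y) ⟧ ℚ.* (c ℚ.* ∑[ w ← vertices ] (step u w ℚ.* f w))
      ≡⟨ exchange ⟦ ¬? (u ≟ y) ⟧ c (∑[ w ← vertices ] (step u w ℚ.* f w)) ⟩
    c ℚ.* killed f u ∎
    where
    open ≡.≡-Reasoning
    open ℚ-Solver using (solve; _:=_; _:*_)
    exchange : ∀ p q r → p ℚ.* (q ℚ.* r) ≡ q ℚ.* (p ℚ.* r)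
    exchange = solve 3 (λ p q r → p :* (q :* r) := q :* (p :* r)) ≡.refl

  killed-mono : ∀ {f g} → (∀ u → f u ℚ.≤ g u) → ∀ u → killed f u ℚ.≤ killed g u
  killed-mono f≤g u = *-monoˡ (0≤⟦⟧ (¬? (u ≟ y))) (∑-mono vertices (λ w → *-monoˡ (0≤step u w) (f≤g w)))

  killed-zero : ∀ u → killed (λ _ → 0ℚ) u ≡ 0ℚ
  killed-zero u = ≡.trans (≡.cong (⟦ ¬? (u ≟ y) ⟧ ℚ.*_) (∑-zero vertices (λ w → ℚₚ.*-zeroʳ (step u w))))
                          (ℚₚ.*-zeroʳ ⟦ ¬? (u ≟ y) ⟧)

  killed-0≤ : ∀ {f} → (∀ u → 0ℚ ℚ.≤ f u) → ∀ u → 0ℚ ℚ.≤ killed f u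
  killed-0≤ {f} 0≤f u = ≡.subst (ℚ._≤ killed f u) (killed-zero u) (killed-mono 0≤f u)

  module Solution
    (h : V G → ℚ) (C : ℕ) (1≤C : 1 ℕ.≤ C)
    (transition : ∀ {u} → u ≢ y → ∑[ w ← vertices ] step u w ≡ 1ℚ)
    (h-target : h y ≡ 0ℚ)
    (h-harmonic : ∀ {u} → u ≢ y → h u ≡ 1ℚ ℚ.+ ∑[ w ← vertices ] (step u w ℚ.* h w))
    (0≤h : ∀ u → 0ℚ ℚ.≤ h u)
    (h≤C : ∀ u → h u ℚ.≤ ι C)
    where

    -- alive t u is P_u(T_y > t), and remaining t u is the expectation of h(Z_t) on that event.
    alive remaining : ℕ → V G → ℚ
    alive zero    u = ⟦ ¬? (u ≟ y) ⟧
    alive (suc t) u = killed (alive t) u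
    remaining zero    u = h u
    remaining (suc t) u = killed (remaining t) u

    -- At time 0 this is h = 1 + Qh off y together with h = 0 at y; linearity of Q carries it to all
    -- times.
    remaining-drop : ∀ t u → remaining t u ≡ alive t u ℚ.+ remaining (suc t) u
    remaining-drop zero u = initial (u ≟ y)
      where
      next = ∑[ w ← vertices ] (step u w ℚ.* h w)
      initial : (d : Dec (u ≡ y)) → h u ≡ ⟦ ¬? d ⟧ ℚ.+ ⟦ ¬? d ⟧ ℚ.* next
      initial (yes ≡.refl) =
        ≡.trans h-target (≡.sym (≡.trans (ℚₚ.+-identityˡ (0ℚ ℚ.* next)) (ℚₚ.*-zeroˡ next)))
      initial (no u≢y)     = ≡.trans (h-harmonic u≢y) (≡.cong (1ℚ ℚ.+_) (≡.sym (ℚₚ.*-identityˡ next)))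
    remaining-drop (suc t) u = ≡.trans (killed-cong (remaining-drop t) u) (killed-+ (alive t) (remaining (suc t)) u)

    killed-one : ∀ u → killed (λ _ → 1ℚ) u ≡ ⟦ ¬? (u ≟ y) ⟧
    killed-one u = ≡.trans (≡.cong (⟦ ¬? (u ≟ y) ⟧ ℚ.*_) (∑-cong vertices (λ w → ℚₚ.*-identityʳ (step u w))))
                           (evaluate (u ≟ y))
      where
      evaluate : (d : Dec (u ≡ y)) → ⟦ ¬? d ⟧ ℚ.* ∑[ w ← vertices ] step u w ≡ ⟦ ¬? d ⟧
      evaluate (yes _)  = ℚₚ.*-zeroˡ (∑[ w ← vertices ] step u w)
      evaluate (no u≢y) = ≡.trans (ℚₚ.*-identityˡ (∑[ w ← vertices ] step u w)) (transition u≢y)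

    hit-or-alive : ∀ u → hit 0 u ℚ.+ alive 0 u ≡ 1ℚ
    hit-or-alive u = ≡.trans (≡.cong (ℚ._+ alive 0 u) (hit-zero u)) (evaluate (u ≟ y))
      where
      evaluate : (d : Dec (u ≡ y)) → ⟦ d ⟧ ℚ.+ ⟦ ¬? d ⟧ ≡ 1ℚ
      evaluate (yes _) = ≡.refl
      evaluate (no _)  = ≡.refl

    -- `alive 0` is Q applied to the constant 1, because the step probabilities off y add up to 1.
    -- Applying Q to `hit-or-alive` gives the case of time 0, and linearity gives the rest.
    alive-drop : ∀ t u → alive t u ≡ hit (suc t) u ℚ.+ alive (suc t) u
    alive-drop zero u = begin
      alive 0 u                                   ≡⟨ killed-one u ⟨
      killed (λ _ → 1ℚ) u                         ≡⟨ killed-cong hit-or-alive u ⟨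
      killed (λ w → hit 0 w ℚ.+ alive 0 w) u      ≡⟨ killed-+ (hit 0) (alive 0) u ⟩
      killed (hit 0) u ℚ.+ alive 1 u              ≡⟨ ≡.cong (ℚ._+ alive 1 u) (hit-suc 0 u) ⟨
      hit 1 u ℚ.+ alive 1 u                       ∎
      where open ≡.≡-Reasoning
    alive-drop (suc t) u = begin
      killed (alive t) u                                        ≡⟨ killed-cong (alive-drop t) u ⟩
      killed (λ w → hit (suc t) w ℚ.+ alive (suc t) w) u        ≡⟨ killed-+ (hit (suc t)) (alive (suc t)) u ⟩
      killed (hit (suc t)) u ℚ.+ alive (suc (suc t)) u          ≡⟨ ≡.cong (ℚ._+ alive (suc (suc t)) u)
                                                                            (hit-suc (suc t) u) ⟨
      hit (suc (suc t)) u ℚ.+ alive (suc (suc t)) u             ∎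
      where open ≡.≡-Reasoning

    0≤alive : ∀ t u → 0ℚ ℚ.≤ alive t u
    0≤alive zero    u = 0≤⟦⟧ (¬? (u ≟ y))
    0≤alive (suc t) = killed-0≤ (0≤alive t)

    0≤remaining : ∀ t u → 0ℚ ℚ.≤ remaining t u
    0≤remaining zero    = 0≤h
    0≤remaining (suc t) = killed-0≤ (0≤remaining t)

    -- As h vanishes at y, the bound h ≤ C sharpens to C times the indicator of the vertices other
    -- than y, and Q is monotone. Since `alive` is the drop of `remaining`, this is the contraction
    -- that `Decay` asks for.
    remaining≤C*alive : ∀ t u → remaining t u ℚ.≤ ι C ℚ.* alive t u
    remaining≤C*alive zero u = initial (u ≟ y)
      where
      initial : (d : Dec (u ≡ y)) → h u ℚ.≤ ι C ℚ.* ⟦ ¬? d ⟧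
      initial (yes ≡.refl) = ℚₚ.≤-reflexive (≡.trans h-target (≡.sym (ℚₚ.*-zeroʳ (ι C))))
      initial (no _)       = ≡.subst (h u ℚ.≤_) (≡.sym (ℚₚ.*-identityʳ (ι C))) (h≤C u)
    remaining≤C*alive (suc t) u = ≡.subst (remaining (suc t) u ℚ.≤_) (killed-scale (ι C) (alive t) u)
      (killed-mono (remaining≤C*alive t) u)

    module _ (u : V G) where

      drop≡alive : ∀ t → remaining t u ℚ.- remaining (suc t) u ≡ alive t u
      drop≡alive t = ≡.trans (≡.cong (ℚ._- remaining (suc t) u) (remaining-drop t u))
        (solve 2 (λ q r → (q :+ r) :- r := q) ≡.refl (alive t u) (remaining (suc t) u))
        where open ℚ-Solver using (solve; _:=_; _:+_; _:-_)

      open Decay (λ t → remaining t u) C 1≤C (λ t → 0≤remaining t u)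
        (λ t → ≡.subst (0ℚ ℚ.≤_) (≡.sym (drop≡alive t)) (0≤alive t u))
        (λ t → ≡.subst (λ d → remaining t u ℚ.≤ ι C ℚ.* d) (≡.sym (drop≡alive t)) (remaining≤C*alive t u))
        (h≤C u)

      alive≤remaining : ∀ t → alive t u ℚ.≤ remaining t u
      alive≤remaining t = ≡.subst (alive t u ℚ.≤_) (≡.sym (remaining-drop t u))
        (≤-+ʳ (alive t u) (0≤remaining (suc t) u))

      ∑-upTo-suc : ∀ (f : ℕ → ℚ) n → ∑ (upTo (suc n)) f ≡ ∑ (upTo n) f ℚ.+ f n
      ∑-upTo-suc f n = begin
        ∑ (upTo (suc n)) f               ≡⟨ ≡.cong (λ ts → ∑ ts f) (upTo-∷ʳ n) ⟨
        ∑ (upTo n List.∷ʳ n) f           ≡⟨ ∑-++ (upTo n) (n ∷ []) f ⟩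
        ∑ (upTo n) f ℚ.+ (f n ℚ.+ 0ℚ)    ≡⟨ ≡.cong (∑ (upTo n) f ℚ.+_) (ℚₚ.+-identityʳ (f n)) ⟩
        ∑ (upTo n) f ℚ.+ f n             ∎
        where open ≡.≡-Reasoning

      hit-total : ∀ n → ∑ (upTo (suc n)) (λ t → hit t u) ℚ.+ alive n u ≡ 1ℚ
      hit-total zero    = ≡.trans (≡.cong (ℚ._+ alive 0 u) (ℚₚ.+-identityʳ (hit 0 u))) (hit-or-alive u)
      hit-total (suc n) = begin
        ∑ (upTo (suc (suc n))) φ ℚ.+ alive (suc n) u
          ≡⟨ ≡.cong (ℚ._+ alive (suc n) u) (∑-upTo-suc φ (suc n)) ⟩
        ∑ (upTo (suc n)) φ ℚ.+ hit (suc n) u ℚ.+ alive (suc n) u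
          ≡⟨ ℚₚ.+-assoc (∑ (upTo (suc n)) φ) (hit (suc n) u) (alive (suc n) u) ⟩
        ∑ (upTo (suc n)) φ ℚ.+ (hit (suc n) u ℚ.+ alive (suc n) u)
          ≡⟨ ≡.cong (∑ (upTo (suc n)) φ ℚ.+_) (alive-drop n u) ⟨
        ∑ (upTo (suc n)) φ ℚ.+ alive n u
          ≡⟨ hit-total n ⟩
        1ℚ ∎
        where
        open ≡.≡-Reasoning
        φ : ℕ → ℚ
        φ t = hit t u

      -- The defect stands for the expectation of T_y on the event T_y > n: n for the steps already
      -- made and h(Z_n) for those to come. From n to n + 1 the sum stays the same by `alive-drop`
      -- and `remaining-drop`.
      hit-mean : ∀ n → ∑ (upTo (suc n)) (λ t → ι t ℚ.* hit t u) ℚ.+ (remaining n u ℚ.+ ι n ℚ.* alive n u) ≡ h u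
      hit-mean zero = solve 3 (λ p r q → (con (ι 0) :* p :+ con 0ℚ) :+ (r :+ con (ι 0) :* q) := r) ≡.refl
                        (hit 0 u) (h u) (alive 0 u)
        where open ℚ-Solver using (solve; _:=_; _:+_; _:*_; con)
      hit-mean (suc n) = begin
        ∑ (upTo (suc (suc n))) φ ℚ.+ (r′ ℚ.+ ι (suc n) ℚ.* q′)
          ≡⟨ ≡.cong (ℚ._+ (r′ ℚ.+ ι (suc n) ℚ.* q′)) (∑-upTo-suc φ (suc n)) ⟩
        ∑ (upTo (suc n)) φ ℚ.+ ι (suc n) ℚ.* hit (suc n) u ℚ.+ (r′ ℚ.+ ι (suc n) ℚ.* q′)
          ≡⟨ ≡.cong (λ m → ∑ (upTo (suc n)) φ ℚ.+ m ℚ.* hit (suc n) u ℚ.+ (r′ ℚ.+ m ℚ.* q′)) (ι-suc n) ⟩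
        ∑ (upTo (suc n)) φ ℚ.+ (1ℚ ℚ.+ ι n) ℚ.* hit (suc n) u ℚ.+ (r′ ℚ.+ (1ℚ ℚ.+ ι n) ℚ.* q′)
          ≡⟨ solve 5 (λ s m p q r → s :+ (con 1ℚ :+ m) :* p :+ (r :+ (con 1ℚ :+ m) :* q) :=
                                    s :+ (((p :+ q) :+ r) :+ m :* (p :+ q))) ≡.refl
               (∑ (upTo (suc n)) φ) (ι n) (hit (suc n) u) q′ r′ ⟩
        ∑ (upTo (suc n)) φ ℚ.+ (hit (suc n) u ℚ.+ q′ ℚ.+ r′ ℚ.+ ι n ℚ.* (hit (suc n) u ℚ.+ q′))
          ≡⟨ ≡.cong (λ q → ∑ (upTo (suc n)) φ ℚ.+ (q ℚ.+ r′ ℚ.+ ι n ℚ.* q)) (alive-drop n u) ⟨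
        ∑ (upTo (suc n)) φ ℚ.+ (alive n u ℚ.+ r′ ℚ.+ ι n ℚ.* alive n u)
          ≡⟨ ≡.cong (λ r → ∑ (upTo (suc n)) φ ℚ.+ (r ℚ.+ ι n ℚ.* alive n u)) (remaining-drop n u) ⟨
        ∑ (upTo (suc n)) φ ℚ.+ (remaining n u ℚ.+ ι n ℚ.* alive n u)
          ≡⟨ hit-mean n ⟩
        h u ∎
        where
        open ≡.≡-Reasoning
        open ℚ-Solver using (solve; _:=_; _:+_; _:*_; con)
        φ : ℕ → ℚ
        φ t = ι t ℚ.* hit t u
        r′ = remaining (suc n) u
        q′ = alive (suc n) u

      tail≤ : ∀ n → remaining n u ℚ.+ ι n ℚ.* alive n u ℚ.≤ ι (suc n) ℚ.* remaining n u
      tail≤ n = begin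
        remaining n u ℚ.+ ι n ℚ.* alive n u      ≤⟨ ℚₚ.+-monoʳ-≤ (remaining n u) (*-monoˡ (0≤ι n) (alive≤remaining n)) ⟩
        remaining n u ℚ.+ ι n ℚ.* remaining n u  ≡⟨ solve 2 (λ r m → r :+ m :* r := (con 1ℚ :+ m) :* r) ≡.refl
                                                      (remaining n u) (ι n) ⟩
        (1ℚ ℚ.+ ι n) ℚ.* remaining n u           ≡⟨ ≡.cong (ℚ._* remaining n u) (ι-suc n) ⟨
        ι (suc n) ℚ.* remaining n u              ∎
        where
        open ℚₚ.≤-Reasoning
        open ℚ-Solver using (solve; _:=_; _:+_; _:*_; con)

      alive≤tail : ∀ n → alive n u ℚ.≤ remaining n u ℚ.+ ι n ℚ.* alive n u
      alive≤tail n = ℚₚ.≤-trans (alive≤remaining n) (≤-+ʳ (remaining n u) (0≤* (0≤ι n) (0≤alive n u)))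

      tail-decay : ∀ n → ι (suc n) ℚ.* (remaining n u ℚ.+ ι n ℚ.* alive n u) ℚ.≤ ι bound
      tail-decay n = ℚₚ.≤-trans (*-monoˡ (0≤ι (suc n)) (tail≤ n)) (quadratic-decay n)

      isHittingTime : IsHittingTime G u y (h u)
      isHittingTime =
        converges-from-below {λ n → ∑ (upTo n) (λ t → hit t u)} (λ n → alive n u) bound hit-total (λ n → 0≤alive n u)
          -- The defect of the total probability is dominated by that of the mean, so one bound
          -- serves both series.
          (λ n → ℚₚ.≤-trans (*-monoˡ (0≤ι (suc n)) (alive≤tail n)) (tail-decay n)) ,
        converges-from-below {λ n → ∑ (upTo n) (λ t → ι t ℚ.* hit t u)}
          (λ n → remaining n u ℚ.+ ι n ℚ.* alive n u) bound hit-mean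
          (λ n → 0≤+ (0≤remaining n u) (0≤* (0≤ι n) (0≤alive n u))) tail-decay

-- Hitting and commute times through forest counts

module CommuteTime (G : Graph) (connected : Connected G) where
  open Graph G hiding (V; order; degree; Reachable)
  open RandomWalk G hiding (IsHittingTime)
  open Edges G
  open Counting G using (hittingWeight; hittingWeight-target; hittingWeight-harmonic; hittingWeight-commute; τ>0)
  open NaturalSums using (length-filter-∑; term≤∑)
  module ∑ℕ = NaturalSums
  open Summation (CommutativeRing.commutativeSemiring ℚₚ.+-*-commutativeRing)

  ι-⟦⟧ : ∀ {P : Set} (P? : Dec P) → ι ∑ℕ.⟦ P? ⟧ ≡ ⟦ P? ⟧
  ι-⟦⟧ (yes _) = ≡.refl
  ι-⟦⟧ (no _)  = ≡.refl

  ι-∑ : ∀ {A : Set} (xs : List A) (f : A → ℕ) → ι (∑ℕ.∑ xs f) ≡ ∑[ x ← xs ] ι (f x)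
  ι-∑ []       f = ≡.refl
  ι-∑ (x ∷ xs) f = ≡.trans (ι-+ (f x) (∑ℕ.∑ xs f)) (≡.cong (ι (f x) ℚ.+_) (ι-∑ xs f))

  instance
    τ-nonZero : NonZero (τ G)
    τ-nonZero = ℕ.>-nonZero (τ>0 connected)

  1/τ : ℚ
  1/τ = + 1 / τ G

  τ*1/τ : ι (τ G) ℚ.* 1/τ ≡ 1ℚ
  τ*1/τ = ι-/ 1 (τ G)

  0≤1/τ : 0ℚ ℚ.≤ 1/τ
  0≤1/τ = ℚₚ.nonNegative⁻¹ 1/τ {{ℚₚ.normalize-nonNeg 1 (τ G)}}

  1/τ≤1 : 1/τ ℚ.≤ 1ℚ
  1/τ≤1 = begin
    1/τ                ≡⟨ ℚₚ.*-identityˡ 1/τ ⟨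
    1ℚ ℚ.* 1/τ         ≤⟨ *-monoʳ 0≤1/τ (ι-mono (τ>0 connected)) ⟩
    ι (τ G) ℚ.* 1/τ    ≡⟨ τ*1/τ ⟩
    1ℚ                 ∎
    where open ℚₚ.≤-Reasoning

  -- Connectedness provides a walk from u to a different vertex, and its first step shows that the
  -- degree is positive; the default value of `reciprocal` at 0 is thus excluded.
  degree*reciprocal : ∀ {u y} → u ≢ y → ι (degree G u) ℚ.* reciprocal (degree G u) ≡ 1ℚ
  degree*reciprocal {u} {y} u≢y = cancel (degree G u) (degree-positive (connected u y))
    where
    cancel : ∀ d → 0 ℕ.< d → ι d ℚ.* reciprocal d ≡ 1ℚ
    cancel (suc d) _ = ι-/ 1 (suc d)
    degree-positive : Reachable G u y → 0 ℕ.< degree G u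
    degree-positive ε = contradiction ≡.refl u≢y
    degree-positive (_◅_ {j = z} u~z _) = ≡.subst (0 ℕ.<_) (≡.sym (length-filter-∑ (adj? u) vertices))
      (ℕₚ.≤-trans (ℕₚ.≤-reflexive (≡.sym (∑ℕ.⟦⟧-yes (adj? u z) u~z)))
                  (term≤∑ (λ z → ∑ℕ.⟦ adj? u z ⟧) (∈-vertices z)))

  module _ (y : V G) where

    h : V G → ℚ
    h u = ι (hittingWeight u y) ℚ.* 1/τ

    -- A crude bound on all values of h at once, using 1/τ ≤ 1. The successor guarantees 1 ≤ C.
    C : ℕ
    C = suc (∑ℕ.∑ vertices (λ u → hittingWeight u y))

    h≤C : ∀ u → h u ℚ.≤ ι C
    h≤C u = begin
      ι (hittingWeight u y) ℚ.* 1/τ   ≤⟨ *-monoˡ (0≤ι (hittingWeight u y)) 1/τ≤1 ⟩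
      ι (hittingWeight u y) ℚ.* 1ℚ    ≡⟨ ℚₚ.*-identityʳ (ι (hittingWeight u y)) ⟩
      ι (hittingWeight u y)           ≤⟨ ι-mono (ℕₚ.m≤n⇒m≤1+n (term≤∑ (λ u → hittingWeight u y) (∈-vertices u))) ⟩
      ι C                             ∎
      where open ℚₚ.≤-Reasoning

    h-target : h y ≡ 0ℚ
    h-target = ≡.trans (≡.cong (λ n → ι n ℚ.* 1/τ) (hittingWeight-target y)) (ℚₚ.*-zeroˡ 1/τ)

    open HittingTime G y using (step-∑; module Solution)

    transition : ∀ {u} → u ≢ y → ∑[ w ← vertices ] step u w ≡ 1ℚ
    transition {u} u≢y = begin
      ∑[ w ← vertices ] step u w
        ≡⟨ ∑-cong vertices (λ w → ℚₚ.*-identityʳ (step u w)) ⟨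
      ∑[ w ← vertices ] (step u w ℚ.* 1ℚ)
        ≡⟨ step-∑ u (λ _ → 1ℚ) ⟩
      reciprocal (degree G u) ℚ.* ∑[ w ← vertices ] (⟦ adj? u w ⟧ ℚ.* 1ℚ)
        ≡⟨ ≡.cong (reciprocal (degree G u) ℚ.*_) neighbours ⟩
      reciprocal (degree G u) ℚ.* ι (degree G u)
        ≡⟨ ℚₚ.*-comm (reciprocal (degree G u)) (ι (degree G u)) ⟩
      ι (degree G u) ℚ.* reciprocal (degree G u)
        ≡⟨ degree*reciprocal u≢y ⟩
      1ℚ ∎
      where
      open ≡.≡-Reasoning
      neighbours : ∑[ w ← vertices ] (⟦ adj? u w ⟧ ℚ.* 1ℚ) ≡ ι (degree G u)
      neighbours = ≡.sym (≡.trans (≡.cong ι (length-filter-∑ (adj? u) vertices))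
        (≡.trans (ι-∑ vertices (λ w → ∑ℕ.⟦ adj? u w ⟧))
                 (∑-cong vertices (λ w → ≡.trans (ι-⟦⟧ (adj? u w)) (≡.sym (ℚₚ.*-identityʳ ⟦ adj? u w ⟧))))))

    h-harmonic : ∀ {u} → u ≢ y → h u ≡ 1ℚ ℚ.+ ∑[ w ← vertices ] (step u w ℚ.* h w)
    h-harmonic {u} u≢y = begin
      H ℚ.* 1/τ
        ≡⟨ ℚₚ.*-identityʳ (H ℚ.* 1/τ) ⟨
      H ℚ.* 1/τ ℚ.* 1ℚ
        ≡⟨ ≡.cong (H ℚ.* 1/τ ℚ.*_) (degree*reciprocal u≢y) ⟨
      H ℚ.* 1/τ ℚ.* (δ ℚ.* ρ)
        ≡⟨ solve 4 (λ H t d r → H :* t :* (d :* r) := r :* (d :* H) :* t) ≡.refl H 1/τ δ ρ ⟩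
      ρ ℚ.* (δ ℚ.* H) ℚ.* 1/τ
        ≡⟨ ≡.cong (λ e → ρ ℚ.* e ℚ.* 1/τ) balance ⟩
      ρ ℚ.* (next ℚ.+ δ ℚ.* ι (τ G)) ℚ.* 1/τ
        ≡⟨ solve 5 (λ r n d t s → r :* (n :+ d :* t) :* s := (d :* r) :* (t :* s) :+ r :* (n :* s)) ≡.refl
             ρ next δ (ι (τ G)) 1/τ ⟩
      (δ ℚ.* ρ) ℚ.* (ι (τ G) ℚ.* 1/τ) ℚ.+ ρ ℚ.* (next ℚ.* 1/τ)
        ≡⟨ ≡.cong₂ (λ a b → a ℚ.* b ℚ.+ ρ ℚ.* (next ℚ.* 1/τ)) (degree*reciprocal u≢y) τ*1/τ ⟩
      1ℚ ℚ.+ ρ ℚ.* (next ℚ.* 1/τ)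
        ≡⟨ ≡.cong (λ e → 1ℚ ℚ.+ ρ ℚ.* e) (*-distribʳ-∑ vertices 1/τ (λ w → ⟦ adj? u w ⟧ ℚ.* ι (hittingWeight w y))) ⟩
      1ℚ ℚ.+ ρ ℚ.* ∑[ w ← vertices ] (⟦ adj? u w ⟧ ℚ.* ι (hittingWeight w y) ℚ.* 1/τ)
        ≡⟨ ≡.cong (λ e → 1ℚ ℚ.+ ρ ℚ.* e) (∑-cong vertices (λ w → ℚₚ.*-assoc ⟦ adj? u w ⟧ (ι (hittingWeight w y)) 1/τ)) ⟩
      1ℚ ℚ.+ ρ ℚ.* ∑[ w ← vertices ] (⟦ adj? u w ⟧ ℚ.* h w)
        ≡⟨ ≡.cong (1ℚ ℚ.+_) (step-∑ u h) ⟨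
      1ℚ ℚ.+ ∑[ w ← vertices ] (step u w ℚ.* h w) ∎
      where
      open ≡.≡-Reasoning
      open ℚ-Solver using (solve; _:=_; _:+_; _:*_)
      H = ι (hittingWeight u y)
      δ = ι (degree G u)
      ρ = reciprocal (degree G u)
      next = ∑[ w ← vertices ] (⟦ adj? u w ⟧ ℚ.* ι (hittingWeight w y))
      balance : δ ℚ.* H ≡ next ℚ.+ δ ℚ.* ι (τ G)
      balance = begin
        δ ℚ.* H
          ≡⟨ ι-* (degree G u) (hittingWeight u y) ⟨
        ι (degree G u ℕ.* hittingWeight u y)
          ≡⟨ ≡.cong ι (hittingWeight-harmonic u≢y) ⟩
        ι (∑ℕ.∑ vertices (λ z → ∑ℕ.⟦ adj? u z ⟧ ℕ.* hittingWeight z y) ℕ.+ degree G u ℕ.* τ G)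
          ≡⟨ ι-+ (∑ℕ.∑ vertices (λ z → ∑ℕ.⟦ adj? u z ⟧ ℕ.* hittingWeight z y)) (degree G u ℕ.* τ G) ⟩
        ι (∑ℕ.∑ vertices (λ z → ∑ℕ.⟦ adj? u z ⟧ ℕ.* hittingWeight z y)) ℚ.+ ι (degree G u ℕ.* τ G)
          ≡⟨ ≡.cong₂ ℚ._+_
               (≡.trans (ι-∑ vertices (λ z → ∑ℕ.⟦ adj? u z ⟧ ℕ.* hittingWeight z y))
                        (∑-cong vertices (λ z → ≡.trans (ι-* ∑ℕ.⟦ adj? u z ⟧ (hittingWeight z y))
                                                        (≡.cong (ℚ._* ι (hittingWeight z y)) (ι-⟦⟧ (adj? u z))))))
               (ι-* (degree G u) (τ G)) ⟩
        next ℚ.+ δ ℚ.* ι (τ G) ∎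

    hittingTime : ∀ u → IsHittingTime G u y (h u)
    hittingTime = Solution.isHittingTime h C (ℕ.s≤s ℕ.z≤n) transition h-target h-harmonic
      (λ u → 0≤* (0≤ι (hittingWeight u y)) 0≤1/τ) h≤C

  commute-time : ∀ x y D .{{_ : NonZero D}} → ∑ℕ.∑ vertices (degree G) ≡ D →
                 ι (F G x y) ≡ (+ τ G / D) ℚ.* (h y x ℚ.+ h x y)
  commute-time x y D total = begin
    f
      -- The factors 1 make room for τ · 1/τ, whose τ is then written as D · (τ/D); the freed D
      -- combines with the forest count into the sum of the two weights.
      ≡⟨ ≡.trans (ℚₚ.*-identityʳ (f ℚ.* 1ℚ)) (ℚₚ.*-identityʳ f) ⟨
    f ℚ.* 1ℚ ℚ.* 1ℚ
      ≡⟨ ≡.cong (λ e → f ℚ.* 1ℚ ℚ.* e) τ*1/τ ⟨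
    f ℚ.* 1ℚ ℚ.* (ι (τ G) ℚ.* 1/τ)
      ≡⟨ ≡.cong (λ e → f ℚ.* 1ℚ ℚ.* (e ℚ.* 1/τ)) (ι-/ (τ G) D) ⟨
    f ℚ.* 1ℚ ℚ.* (ι D ℚ.* (+ τ G / D) ℚ.* 1/τ)
      ≡⟨ solve 4 (λ f d q t → f :* con 1ℚ :* (d :* q :* t) := q :* (d :* f :* t)) ≡.refl f (ι D) (+ τ G / D) 1/τ ⟩
    (+ τ G / D) ℚ.* (ι D ℚ.* f ℚ.* 1/τ)
      ≡⟨ ≡.cong (λ e → (+ τ G / D) ℚ.* (e ℚ.* 1/τ)) weights ⟨
    (+ τ G / D) ℚ.* ((ι (hittingWeight x y) ℚ.+ ι (hittingWeight y x)) ℚ.* 1/τ)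
      ≡⟨ ≡.cong ((+ τ G / D) ℚ.*_) (ℚₚ.*-distribʳ-+ 1/τ (ι (hittingWeight x y)) (ι (hittingWeight y x))) ⟩
    (+ τ G / D) ℚ.* (h y x ℚ.+ h x y) ∎
    where
    open ≡.≡-Reasoning
    open ℚ-Solver using (solve; _:=_; _:*_; con)
    f = ι (F G x y)
    weights : ι (hittingWeight x y) ℚ.+ ι (hittingWeight y x) ≡ ι D ℚ.* f
    weights = ≡.trans (≡.sym (ι-+ (hittingWeight x y) (hittingWeight y x)))
      (≡.trans (≡.cong ι (≡.trans (hittingWeight-commute x y) (≡.cong (ℕ._* F G x y) total)))
               (ι-* D (F G x y)))

-- Degrees in regular graphs and Cartesian products

module Degrees (G : Graph) where
  open Graph G hiding (V; order; degree; Reachable)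
  open NaturalSums

  ∑-point : ∀ v → ∑[ w ← vertices ] ⟦ v ≟ w ⟧ ≡ 1
  ∑-point v = ∑-unique (v ≟_) (Edges.vertices-unique G) (λ _ _ p q → ≡.trans (≡.sym p) q)
    (yes ≡.refl) (λ v≡v → v , ∈-vertices v , v≡v) (λ _ _ → ≡.refl)

  regular-degree-sum : ∀ {d} → Regular G d → ∑[ v ← vertices ] degree G v ≡ order G ℕ.* d
  regular-degree-sum {d} regular = ≡.trans (∑-cong vertices regular)
    (≡.trans (∑-const vertices d) (≡.cong (ℕ._* d) length-vertices))
    where
    length-vertices : length vertices ≡ order G
    length-vertices = ≡.trans (length-map vertex (allFin (order G))) (length-tabulate {n = order G} id)

module Product (G H : Graph) where
  private
    module G = Graph G
    module H = Graph H
    module X = Graph (G □ H)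
  open NaturalSums
  open ≡.≡-Reasoning

  -- Row y contributes the edge to (y , a) if x and y are adjacent, and all neighbours of a if y is
  -- x. The two kinds of adjacency exclude each other, since adjacent vertices a and b are distinct.
  degree-□ : ∀ x a → degree (G □ H) (x , a) ≡ degree G x ℕ.+ degree H a
  degree-□ x a = begin
    degree (G □ H) (x , a)
      ≡⟨ length-filter-∑ (X.adj? (x , a)) X.vertices ⟩
    ∑[ v ← X.vertices ] ⟦ X.adj? (x , a) v ⟧
      -- The product lists its vertices through its indexing; on the product of the two vertex lists
      -- the sum splits by coordinates.
      ≡⟨ ∑-enumeration (λ v → ⟦ X.adj? (x , a) v ⟧) X._≟_ (Edges.vertices-unique (G □ H)) X.∈-vertices
           (Unique.cartesianProduct⁺ (Edges.vertices-unique G) (Edges.vertices-unique H))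
           (λ (y , b) → ∈-cartesianProduct⁺ (G.∈-vertices y) (H.∈-vertices b)) ⟩
    ∑[ v ← cartesianProduct G.vertices H.vertices ] ⟦ X.adj? (x , a) v ⟧
      ≡⟨ ∑-cartesianProduct G.vertices H.vertices (λ v → ⟦ X.adj? (x , a) v ⟧) ⟩
    ∑[ y ← G.vertices ] ∑[ b ← H.vertices ] ⟦ X.adj? (x , a) (y , b) ⟧
      ≡⟨ ∑-cong G.vertices row ⟩
    ∑[ y ← G.vertices ] (⟦ G.adj? x y ⟧ ℕ.+ degree H a ℕ.* ⟦ x G.≟ y ⟧)
      ≡⟨ ∑-distrib-+ G.vertices (λ y → ⟦ G.adj? x y ⟧) (λ y → degree H a ℕ.* ⟦ x G.≟ y ⟧) ⟩
    ∑[ y ← G.vertices ] ⟦ G.adj? x y ⟧ ℕ.+ ∑[ y ← G.vertices ] (degree H a ℕ.* ⟦ x G.≟ y ⟧)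
      ≡⟨ ≡.cong₂ ℕ._+_ (≡.sym (length-filter-∑ (G.adj? x) G.vertices))
           (≡.trans (≡.sym (*-distribˡ-∑ G.vertices (degree H a) (λ y → ⟦ x G.≟ y ⟧)))
             (≡.trans (≡.cong (degree H a ℕ.*_) (Degrees.∑-point G x)) (ℕₚ.*-identityʳ (degree H a)))) ⟩
    degree G x ℕ.+ degree H a ∎
    where
    row : ∀ y → ∑[ b ← H.vertices ] ⟦ X.adj? (x , a) (y , b) ⟧ ≡ ⟦ G.adj? x y ⟧ ℕ.+ degree H a ℕ.* ⟦ x G.≟ y ⟧
    row y = begin
      ∑[ b ← H.vertices ] ⟦ X.adj? (x , a) (y , b) ⟧
        ≡⟨ ∑-cong H.vertices entry ⟩
      ∑[ b ← H.vertices ] (⟦ a H.≟ b ⟧ ℕ.* ⟦ G.adj? x y ⟧ ℕ.+ ⟦ H.adj? a b ⟧ ℕ.* ⟦ x G.≟ y ⟧)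
        ≡⟨ ∑-distrib-+ H.vertices (λ b → ⟦ a H.≟ b ⟧ ℕ.* ⟦ G.adj? x y ⟧) (λ b → ⟦ H.adj? a b ⟧ ℕ.* ⟦ x G.≟ y ⟧) ⟩
      ∑[ b ← H.vertices ] (⟦ a H.≟ b ⟧ ℕ.* ⟦ G.adj? x y ⟧) ℕ.+ ∑[ b ← H.vertices ] (⟦ H.adj? a b ⟧ ℕ.* ⟦ x G.≟ y ⟧)
        ≡⟨ ≡.cong₂ ℕ._+_ (*-distribʳ-∑ H.vertices ⟦ G.adj? x y ⟧ (λ b → ⟦ a H.≟ b ⟧))
                         (*-distribʳ-∑ H.vertices ⟦ x G.≟ y ⟧ (λ b → ⟦ H.adj? a b ⟧)) ⟨
      ∑[ b ← H.vertices ] ⟦ a H.≟ b ⟧ ℕ.* ⟦ G.adj? x y ⟧ ℕ.+ ∑[ b ← H.vertices ] ⟦ H.adj? a b ⟧ ℕ.* ⟦ x G.≟ y ⟧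
        ≡⟨ ≡.cong₂ (λ m n → m ℕ.* ⟦ G.adj? x y ⟧ ℕ.+ n ℕ.* ⟦ x G.≟ y ⟧)
             (Degrees.∑-point H a) (≡.sym (length-filter-∑ (H.adj? a) H.vertices)) ⟩
      1 ℕ.* ⟦ G.adj? x y ⟧ ℕ.+ degree H a ℕ.* ⟦ x G.≟ y ⟧
        ≡⟨ ≡.cong (ℕ._+ degree H a ℕ.* ⟦ x G.≟ y ⟧) (ℕₚ.*-identityˡ ⟦ G.adj? x y ⟧) ⟩
      ⟦ G.adj? x y ⟧ ℕ.+ degree H a ℕ.* ⟦ x G.≟ y ⟧ ∎
      where
      entry : ∀ b → ⟦ X.adj? (x , a) (y , b) ⟧ ≡ ⟦ a H.≟ b ⟧ ℕ.* ⟦ G.adj? x y ⟧ ℕ.+ ⟦ H.adj? a b ⟧ ℕ.* ⟦ x G.≟ y ⟧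
      entry b = ≡.trans
        (⟦⟧-⊎ ((a H.≟ b) ×-dec G.adj? x y) ((x G.≟ y) ×-dec H.adj? a b)
          (λ ((a≡b , _) , (_ , a~b)) → H.adj-irr (≡.subst (H.Adj a) (≡.sym a≡b) a~b)))
        (≡.cong₂ ℕ._+_ (⟦⟧-× (a H.≟ b) (G.adj? x y) ((a H.≟ b) ×-dec G.adj? x y))
          (≡.trans (⟦⟧-× (x G.≟ y) (H.adj? a b) ((x G.≟ y) ×-dec H.adj? a b))
                   (ℕₚ.*-comm ⟦ x G.≟ y ⟧ ⟦ H.adj? a b ⟧)))

  □-regular : ∀ {d e} → Regular G d → Regular H e → Regular (G □ H) (d ℕ.+ e)
  □-regular regularG regularH (x , a) = ≡.trans (degree-□ x a) (≡.cong₂ ℕ._+_ (regularG x) (regularH a))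

  □-connected : Connected G → Connected H → Connected (G □ H)
  □-connected connectedG connectedH (x , a) (y , b) =
    Star.gmap (_, a) (λ x~y → inj₁ (≡.refl , x~y)) (connectedG x y) ◅◅
    Star.gmap (y ,_) (λ a~b → inj₂ (≡.refl , a~b)) (connectedH a b)

-- Circulant graphs

-- N divides the difference of m and n, whose absolute value is below N. The common reference point
-- e covers both offsets and vertices.
residue-unique : ∀ {N} e {m n} → m ℕ.< N → n ℕ.< N →
                 + N ℤ.∣ (e ℤ.- + m) → + N ℤ.∣ (e ℤ.- + n) → m ≡ n
residue-unique {N} e {m} {n} m<N n<N N∣e-m N∣e-n =
  ≡.sym (ℤₚ.+-injective (ℤₚ.i-j≡0⇒i≡j (+ n) (+ m) (ℤₚ.∣i∣≡0⇒i≡0 (small ℤ.∣ + n ℤ.- + m ∣ distance<N N∣n-m))))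
  where
  open ℤ-Solver using (solve; _:=_; _:-_)
  N∣n-m : N ℕ.∣ ℤ.∣ + n ℤ.- + m ∣
  N∣n-m = ≡.subst (λ i → N ℕ.∣ ℤ.∣ i ∣)
    (solve 3 (λ e m n → (e :- m) :- (e :- n) := n :- m) ≡.refl e (+ m) (+ n))
    (Signed.∣⇒∣ᵤ (Signed.∣m∣n⇒∣m-n (Signed.∣ᵤ⇒∣ {+ N} {e ℤ.- + m} N∣e-m) (Signed.∣ᵤ⇒∣ {+ N} {e ℤ.- + n} N∣e-n)))
  distance<N : ℤ.∣ + n ℤ.- + m ∣ ℕ.< N
  distance<N = ≡.subst (λ i → ℤ.∣ i ∣ ℕ.< N) (≡.sym (ℤₚ.m-n≡m⊖n n m))
    (ℕₚ.≤-<-trans (ℤₚ.∣m⊝n∣≤m⊔n n m) (ℕₚ.⊔-lub n<N m<N))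
  small : ∀ l → l ℕ.< N → N ℕ.∣ l → l ≡ 0
  small zero    _   _   = ≡.refl
  small (suc l) l<N N∣l = contradiction N∣l (ℕ.>⇒∤ l<N)

residue-exists : ∀ N .{{_ : NonZero N}} e → ∃ λ m → m ℕ.< N × + N ℤ.∣ (e ℤ.- + m)
residue-exists N e = e ℤ.%ℕ N , ℤ.n%ℕd<d e N , Signed.∣⇒∣ᵤ (Signed.divides (e ℤ./ℕ N) (≡.trans
  (≡.cong (ℤ._- + (e ℤ.%ℕ N)) (ℤ.a≡a%ℕn+[a/ℕn]*n e N))
  (solve 2 (λ r q → (r :+ q) :- r := q) ≡.refl (+ (e ℤ.%ℕ N)) ((e ℤ./ℕ N) ℤ.* + N))))
  where open ℤ-Solver using (solve; _:=_; _:+_; _:-_)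

module CyclePower (N k : ℕ) .{{_ : NonZero N}} (N≥2k+1 : N ≥ 2 ℕ.* k ℕ.+ 1) where
  private
    Γ = cyclePower N k N≥2k+1
  open Graph Γ hiding (V; order; degree; Reachable)
  open NaturalSums
  open ≡.≡-Reasoning

  -- The offsets −k, …, k are shifted to 0, …, 2k; the shifted offset k is the vertex x itself.
  Offset : Fin N → Fin N → ℕ → Set
  Offset x y j = + N ℤ.∣ ((difference N k x y ℤ.+ + k) ℤ.- + j)

  offset? : ∀ x y j → Dec (Offset x y j)
  offset? x y j = N ℕ.∣? ℤ.∣ (difference N k x y ℤ.+ + k) ℤ.- + j ∣

  -- This is where the bound on N makes the 2k + 1 offsets pairwise incongruent.
  offset<N : ∀ {j} → j ℕ.< suc (2 ℕ.* k) → j ℕ.< N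
  offset<N j<2k+1 = ℕₚ.<-≤-trans j<2k+1 (≡.subst (ℕ._≤ N) (ℕₚ.+-comm (2 ℕ.* k) 1) N≥2k+1)

  near⇒offset : ∀ {x y} → x ≡ y ⊎ Adj x y → ∃ λ j → j L.∈ upTo (suc (2 ℕ.* k)) × Offset x y j
  near⇒offset {x} (inj₁ ≡.refl) = k , ∈-upTo⁺ (ℕ.s≤s (ℕₚ.m≤m+n k (k ℕ.+ 0))) ,
    ≡.subst (λ i → N ℕ.∣ ℤ.∣ i ∣) (solve 2 (λ x k → con (+ 0) := ((x :- x) :+ k) :- k) ≡.refl (+ toℕ x) (+ k)) (N ℕ.∣0)
    where open ℤ-Solver using (solve; _:=_; _:+_; _:-_; con)
  near⇒offset {x} {y} (inj₂ (s , 1≤s , s≤k , inj₁ d≡s)) = k ℕ.+ s ,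
    ∈-upTo⁺ (ℕ.s≤s (ℕₚ.+-monoʳ-≤ k (≡.subst (s ℕ.≤_) (≡.sym (ℕₚ.+-identityʳ k)) s≤k))) ,
    ≡.subst (λ i → N ℕ.∣ ℤ.∣ i ∣) (solve 3 (λ d k s → d :- s := (d :+ k) :- (k :+ s)) ≡.refl
      (difference N k x y) (+ k) (+ s)) d≡s
    where open ℤ-Solver using (solve; _:=_; _:+_; _:-_)
  near⇒offset {x} {y} (inj₂ (s , 1≤s , s≤k , inj₂ d≡-s)) = k ℕ.∸ s ,
    ∈-upTo⁺ (ℕ.s≤s (ℕₚ.≤-trans (ℕₚ.m∸n≤m k s) (ℕₚ.m≤m+n k (k ℕ.+ 0)))) ,
    ≡.subst (λ i → N ℕ.∣ ℤ.∣ i ∣) (≡.trans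
      (solve 3 (λ d k s → d :- (:- s) := (d :+ k) :- (k :- s)) ≡.refl (difference N k x y) (+ k) (+ s))
      (≡.cong (λ i → (difference N k x y ℤ.+ + k) ℤ.- i) (≡.trans (ℤₚ.m-n≡m⊖n k s) (ℤₚ.⊖-≥ s≤k)))) d≡-s
    where open ℤ-Solver using (solve; _:=_; _:+_; _:-_; :-_)

  offset⇒near : ∀ {x y j} → j ℕ.< suc (2 ℕ.* k) → Offset x y j → x ≡ y ⊎ Adj x y
  offset⇒near {x} {y} {j} (ℕ.s≤s j≤2k) N∣ with ℕₚ.<-cmp j k
  ... | tri< j<k _ _ = inj₂ (k ℕ.∸ j , ℕₚ.m<n⇒0<n∸m j<k , ℕₚ.m∸n≤m k j , inj₂ (≡.subst (λ i → N ℕ.∣ ℤ.∣ i ∣) (≡.trans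
      (solve 3 (λ d k j → (d :+ k) :- j := d :- (:- (k :- j))) ≡.refl (difference N k x y) (+ k) (+ j))
      (≡.cong (λ i → difference N k x y ℤ.- (ℤ.- i)) (≡.trans (ℤₚ.m-n≡m⊖n k j) (ℤₚ.⊖-≥ (ℕₚ.<⇒≤ j<k))))) N∣))
    where open ℤ-Solver using (solve; _:=_; _:+_; _:-_; :-_)
  ... | tri≈ _ ≡.refl _ = inj₁ (Finₚ.toℕ-injective (≡.sym (residue-unique (+ toℕ x) (Finₚ.toℕ<n y) (Finₚ.toℕ<n x)
      (≡.subst (λ i → N ℕ.∣ ℤ.∣ i ∣) (solve 2 (λ d k → (d :+ k) :- k := d) ≡.refl (difference N k x y) (+ k)) N∣)
      (≡.subst (λ i → N ℕ.∣ ℤ.∣ i ∣) (≡.sym (ℤₚ.+-inverseʳ (+ toℕ x))) (N ℕ.∣0)))))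
    where open ℤ-Solver using (solve; _:=_; _:+_; _:-_)
  ... | tri> _ _ k<j = inj₂ (j ℕ.∸ k , ℕₚ.m<n⇒0<n∸m k<j , j-k≤k , inj₁ (≡.subst (λ i → N ℕ.∣ ℤ.∣ i ∣) (≡.trans
      (solve 3 (λ d k j → (d :+ k) :- j := d :- (j :- k)) ≡.refl (difference N k x y) (+ k) (+ j))
      (≡.cong (λ i → difference N k x y ℤ.- i) (≡.trans (ℤₚ.m-n≡m⊖n j k) (ℤₚ.⊖-≥ (ℕₚ.<⇒≤ k<j))))) N∣))
    where
    open ℤ-Solver using (solve; _:=_; _:+_; _:-_)
    j-k≤k : j ℕ.∸ k ℕ.≤ k
    j-k≤k = ℕₚ.m≤n+o⇒m∸n≤o j k (≡.subst (λ n → j ℕ.≤ k ℕ.+ n) (ℕₚ.+-identityʳ k) j≤2k)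

  -- Adding the vertex itself closes the gap at offset 0, so the closed neighbourhood corresponds to
  -- one interval of residues and the two signs need no separate count.
  ∑-offsets : ∀ x y → ⟦ x ≟ y ⟧ ℕ.+ ⟦ adj? x y ⟧ ≡ ∑[ j ← upTo (suc (2 ℕ.* k)) ] ⟦ offset? x y j ⟧
  ∑-offsets x y = ≡.trans
    (≡.sym (⟦⟧-⊎ (x ≟ y) (adj? x y) (λ (x≡y , x~y) → adj-irr {y} (≡.subst (λ x → Adj x y) x≡y x~y))))
    (≡.sym (∑-unique (offset? x y) (Unique.upTo⁺ (suc (2 ℕ.* k)))
      (λ i∈ j∈ → residue-unique (difference N k x y ℤ.+ + k) (offset<N (∈-upTo⁻ i∈)) (offset<N (∈-upTo⁻ j∈)))
      ((x ≟ y) ⊎-dec adj? x y) near⇒offset (λ j∈ → offset⇒near (∈-upTo⁻ j∈))))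

  ∑-at-offset : ∀ x j → ∑[ y ← vertices ] ⟦ offset? x y j ⟧ ≡ 1
  ∑-at-offset x j = ∑-unique (λ y → offset? x y j) (Edges.vertices-unique Γ)
    (λ {y} {z} _ _ N∣y N∣z → Finₚ.toℕ-injective (residue-unique e (Finₚ.toℕ<n y) (Finₚ.toℕ<n z)
      (to y N∣y) (to z N∣z)))
    (yes ≡.refl) exists (λ _ _ → ≡.refl)
    where
    open ℤ-Solver using (solve; _:=_; _:+_; _:-_)
    -- The vertex with shifted offset j is the residue of x + k - j.
    e = + toℕ x ℤ.+ + k ℤ.- + j
    rearrange : ∀ y → (difference N k x y ℤ.+ + k) ℤ.- + j ≡ e ℤ.- + toℕ y
    rearrange y = solve 4 (λ x y k j → ((x :- y) :+ k) :- j := ((x :+ k) :- j) :- y) ≡.refl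
      (+ toℕ x) (+ toℕ y) (+ k) (+ j)
    to : ∀ y → Offset x y j → + N ℤ.∣ (e ℤ.- + toℕ y)
    to y = ≡.subst (λ i → N ℕ.∣ ℤ.∣ i ∣) (rearrange y)
    exists : 1 ≡ 1 → ∃ λ y → y L.∈ vertices × Offset x y j
    exists _ with m , m<N , N∣ ← residue-exists N e =
      Fin.fromℕ< m<N , ∈-vertices _ , ≡.subst (λ i → N ℕ.∣ ℤ.∣ i ∣)
        (≡.trans (≡.cong (λ n → e ℤ.- + n) (≡.sym (Finₚ.toℕ-fromℕ< m<N))) (≡.sym (rearrange (Fin.fromℕ< m<N)))) N∣

  -- Double counting of the pairs of a vertex y and an offset of it from x: sorted by y they give
  -- the closed neighbourhood, and each of the 2k + 1 offsets is taken by exactly one y.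
  cyclePower-regular : Regular Γ (2 ℕ.* k)
  cyclePower-regular x = ℕₚ.suc-injective (begin
    suc (degree Γ x)
      ≡⟨ ≡.cong₂ ℕ._+_ (≡.sym (Degrees.∑-point Γ x)) (length-filter-∑ (adj? x) vertices) ⟩
    ∑[ y ← vertices ] ⟦ x ≟ y ⟧ ℕ.+ ∑[ y ← vertices ] ⟦ adj? x y ⟧
      ≡⟨ ∑-distrib-+ vertices (λ y → ⟦ x ≟ y ⟧) (λ y → ⟦ adj? x y ⟧) ⟨
    ∑[ y ← vertices ] (⟦ x ≟ y ⟧ ℕ.+ ⟦ adj? x y ⟧)
      ≡⟨ ∑-cong vertices (∑-offsets x) ⟩
    ∑[ y ← vertices ] ∑[ j ← upTo (suc (2 ℕ.* k)) ] ⟦ offset? x y j ⟧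
      ≡⟨ ∑-comm vertices (upTo (suc (2 ℕ.* k))) (λ y j → ⟦ offset? x y j ⟧) ⟩
    ∑[ j ← upTo (suc (2 ℕ.* k)) ] ∑[ y ← vertices ] ⟦ offset? x y j ⟧
      ≡⟨ ∑-cong (upTo (suc (2 ℕ.* k))) (∑-at-offset x) ⟩
    ∑[ _ ← upTo (suc (2 ℕ.* k)) ] 1
      ≡⟨ ∑-const (upTo (suc (2 ℕ.* k))) 1 ⟩
    length (upTo (suc (2 ℕ.* k))) ℕ.* 1
      ≡⟨ ≡.trans (ℕₚ.*-identityʳ (length (upTo (suc (2 ℕ.* k))))) (length-upTo (suc (2 ℕ.* k))) ⟩
    suc (2 ℕ.* k) ∎)

  -- Since 1 ≤ k, consecutive residues are adjacent, and every residue is reached from 0 by unit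
  -- steps.
  cyclePower-connected : 1 ℕ.≤ k → Connected Γ
  cyclePower-connected 1≤k x y = Star.reverse (λ {u} {v} → adj-sym {u} {v}) (from-zero x) ◅◅ from-zero y
    where
    open ℤ-Solver using (solve; _:=_; _:+_; _:-_; con)
    0<N : 0 ℕ.< N
    0<N = ℕ.>-nonZero⁻¹ N
    next : ∀ n (n<N : n ℕ.< N) (1+n<N : suc n ℕ.< N) → Adj (Fin.fromℕ< n<N) (Fin.fromℕ< 1+n<N)
    next n n<N 1+n<N = adj-sym {Fin.fromℕ< 1+n<N} {Fin.fromℕ< n<N}
      (1 , ℕₚ.≤-refl , 1≤k , inj₁ (≡.subst₂ (λ i j → N ℕ.∣ ℤ.∣ (+ i ℤ.- + j) ℤ.- + 1 ∣)
        (≡.sym (Finₚ.toℕ-fromℕ< 1+n<N)) (≡.sym (Finₚ.toℕ-fromℕ< n<N))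
        (≡.subst (λ i → N ℕ.∣ ℤ.∣ i ∣)
          (solve 1 (λ n → con (+ 0) := ((con (+ 1) :+ n) :- n) :- con (+ 1)) ≡.refl (+ n)) (N ℕ.∣0))))
    climb : ∀ n (n<N : n ℕ.< N) → Reachable Γ (Fin.fromℕ< 0<N) (Fin.fromℕ< n<N)
    climb zero    0<N   = ε
    climb (suc n) 1+n<N = climb n n<N ◅◅ (next n n<N 1+n<N ◅ ε)
      where n<N = ℕₚ.<-trans (ℕₚ.n<1+n n) 1+n<N
    from-zero : ∀ x → Reachable Γ (Fin.fromℕ< 0<N) x
    from-zero x = ≡.subst (Reachable Γ (Fin.fromℕ< 0<N)) (Finₚ.fromℕ<-toℕ x (Finₚ.toℕ<n x))
      (climb (toℕ x) (Finₚ.toℕ<n x))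

open import Data.Rational.Base using (_+_; _*_)

proposition5p6 :
    ∀ (N k r : ℕ) .{{_ : NonZero N}} .{{_ : NonZero k}} (N≥2k+1 : N ≥ 2 ℕ.* k ℕ.+ 1) →
    (G : Graph) → Connected G → Regular G r →
    let X = cyclePower N k N≥2k+1 □ G
        m = order G
    in
    ∀ (x y : V X) → x ≢ y →
    let instance
          m≢0 : NonZero m
          m≢0 = order≢0 G (proj₂ x)
          denominator : NonZero (N ℕ.* m ℕ.* (2 ℕ.* k ℕ.+ r))
          denominator = denominator≢0 N m k r
    in
    ∃₂ λ h[x,y] h[y,x] →
      IsHittingTime X x y h[x,y] ×
      IsHittingTime X y x h[y,x] ×
      + F X x y / 1 ≡ (+ τ X / (N ℕ.* m ℕ.* (2 ℕ.* k ℕ.+ r))) * (h[x,y] + h[y,x])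
proposition5p6 N k r N≥2k+1 G connected regular x y x≢y =
  -- The target is the first argument of `h`, so `h y x` is the time from x to y.
  h y x , h x y , hittingTime y x , hittingTime x y ,
  commute-time x y (N ℕ.* order G ℕ.* (2 ℕ.* k ℕ.+ r))
    {{denominator≢0 N (order G) k r {{it}} {{order≢0 G (proj₂ x)}} {{it}}}}
    -- The order of the product is N times the order of G by definition, so the degree sum is
    -- literally the denominator of the theorem.
    (Degrees.regular-degree-sum (cyclePower N k N≥2k+1 □ G) (□-regular cyclePower-regular regular))
  where
  open CyclePower N k N≥2k+1
  open Product (cyclePower N k N≥2k+1) G
  open CommuteTime (cyclePower N k N≥2k+1 □ G) (□-connected (cyclePower-connected (ℕ.>-nonZero⁻¹ k)) connected)
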